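{- Consider the game $\mathbf{0.33}$ and the set $\mathcal{R}$ consisting of the empty graph and all subdivided stars whose paths all have $1$ or $2$ vertices. Define the following subsets of $\mathcal{R}$: $\mathcal C_1^*=\{P_1, S_{2,1}, S_{2,2,2}\}$; $\mathcal C_2^*=\{S_1, S_{2,2}\}$; $\mathcal C_2^{\Box}$ = stars $S\in\mathcal R$ with $\mathcal{G}(S)=2$ having exactly one or exactly three paths with $2$ vertices; $\mathcal C_3^{\Box}$ = stars $S\in\mathcal R$ with $\mathcal{G}(S)=3$ having exactly one or exactly three paths with $2$ vertices; and for $i\in\{0,1,2,3\}$, $\mathcal C_i$ = elements $S\in\mathcal R$ with $\mathcal{G}(S)=i$ not in any of $\mathcal C_1^*,\mathcal C_2^*,\mathcal C_2^{\Box},\mathcal C_3^{\Box}$. Then the equivalence classes of $\mathcal R$ under $\sim_1$ are exactly $\mathcal C_0,\mathcal C_1,\mathcal C_1^*,\mathcal C_2,\mathcal C_2^*,\mathcal C_2^{\Box},\mathcal C_3,\mathcal C_3^{\Box}$. Moreover, for $S,S'\in\mathcal R$, $\mathcal{G}(S\overset{1}{ - }S')=\mathcal{G}(S)\oplus\mathcal{G}(S')$ except in the following cases (and their symmetric ones, swapping $S$ and $S'$): if $S,S'\in\mathcal C_1^*$ then the value is $2$; if $S\in\mathcal C_1^*$, $S'\in\mathcal C_2^*$ then it is $0$; if $S,S'\in\mathcal C_2^*$ then it is $1$; if $S\in\mathcal C_2^*$, $S'\in\mathcal C_2^{\Box}$ then it is $1$; if $S\in\mathcal C_2^*$, $S'\in\mathcal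 C_3^{\Box}$ then it is $0$.
   Context: The game $\mathbf{0.33}$ on a finite graph $G$: players alternate; a move chooses a set $X$ of one vertex or of two adjacent vertices of $G$, lying in a connected component $H$ of $G$, such that $H-X$ is empty or connected, and deletes $X$. A player unable to move loses (normal play). Grundy value: $\mathcal{G}(G)=\mathrm{mex}\{\mathcal{G}(G'): G' \text{ reachable in one move}\}$; $\oplus$ is bitwise XOR (nim-sum). Subdivided star $S_{\ell_1,\ldots,\ell_k}$ ($k\ge0$, $\ell_i\ge1$): a central vertex $c$ with $k$ vertex-disjoint paths of $\ell_1,\ldots,\ell_k$ vertices each having one endpoint adjacent to $c$ ($P_1$ if $k=0$; $S_1=P_2$). Bistar: for subdivided stars $S,S'$ with centers $c,c'$, $S\overset{1}{ - }S'$ is the disjoint union of $S$ and $S'$ plus the edge $cc'$; if one of them is the empty graph, $S\overset{1}{ - }\emptyset=\emptyset\overset{1}{ - }S=S$. Two graphs are equivalent, $G_1\equiv G_2$, iff $\mathcal{G}(G_1)=\mathcal{G}(G_2)$. For $S,S'$ (subdivided stars or empty), $S\sim_1 S'$ iff $S\overset{1}{ - }\hat S\equiv S'\overset{1}{ - }\hat S$ for every subdivided star $\hat S$ (or empty graph $\hat S$). -}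

module Defs where

open import Data.Nat using (ℕ; zero; suc; _+_; _*_; ⌊_/2⌋)
open import Data.Bool using (Bool; true; false; _∧_; _∨_; not; if_then_else_; _xor_)
open import Data.Fin using (Fin; zero; suc; punchIn; inject₁; _↑ˡ_; _↑ʳ_; fromℕ; _≟_)
open import Data.List using (List; []; _∷_; map; _++_; filterᵇ; allFin; concatMap; length; replicate)
open import Data.Bool.ListAction using (any; all)
open import Data.Product using (Σ; _,_; _×_; proj₁; proj₂)
open import Data.Sum using (_⊎_)
open import Relation.Nullary using (¬_)
open import Relation.Nullary.Decidable using (⌊_⌋)
open import Relation.Binary.PropositionalEquality using (_≡_)

oddᵇ : ℕ → Bool
oddᵇ zero          = false
oddᵇ (suc zero)    = true
oddᵇ (suc (suc n)) = oddᵇ n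

bit : Bool → ℕ
bit true  = 1
bit false = 0

-- fuel-driven; fuel a + b exceeds the number of binary digits of a and b
xorF : ℕ → ℕ → ℕ → ℕ
xorF zero     a b = 0
xorF (suc f)  a b = bit (oddᵇ a xor oddᵇ b) + 2 * xorF f ⌊ a /2⌋ ⌊ b /2⌋

infixl 6 _⊕_
_⊕_ : ℕ → ℕ → ℕ
a ⊕ b = xorF (a + b) a b

-- mex of a finite list: least natural not in the list
-- (it is ≤ length xs, so suc (length xs) steps of search suffice)

_∈ᵇ_ : ℕ → List ℕ → Bool
k ∈ᵇ xs = any (λ y → ⌊ k Data.Nat.≟ y ⌋) xs

mexFrom : ℕ → ℕ → List ℕ → ℕ
mexFrom zero    k xs = k
mexFrom (suc f) k xs = if k ∈ᵇ xs then mexFrom f (suc k) xs else k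

mex : List ℕ → ℕ
mex xs = mexFrom (suc (length xs)) 0 xs

-- Finite simple graphs on vertex set Fin n, given by a (symmetric,
-- loopless) Boolean adjacency relation.

Adj : ℕ → Set
Adj n = Fin n → Fin n → Bool

anyV : ∀ {n} → (Fin n → Bool) → Bool
anyV {n} p = any p (allFin n)

allV : ∀ {n} → (Fin n → Bool) → Bool
allV {n} p = all p (allFin n)

closeStep : ∀ {n} → Adj n → (Fin n → Bool) → (Fin n → Bool)
closeStep g S v = S v ∨ anyV (λ u → S u ∧ g u v)

iterate : ∀ {n} → ℕ → Adj n → (Fin n → Bool) → (Fin n → Bool)
iterate zero    g S = S
iterate (suc k) g S = iterate k g (closeStep g S)

reach : ∀ {n} → Adj n → Fin n → (Fin n → Bool)
reach {n} g s = iterate n g (λ v → ⌊ v ≟ s ⌋)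

-- the vertex set T (of graph g) induces an empty or connected subgraph of g
-- (applied with g = G - X, whose components are unions of parts of
--  components of G; reachability inside G - X from a vertex of H stays in H)
emptyOrConnected : ∀ {n} → Adj n → (Fin n → Bool) → Bool
emptyOrConnected g T = allV (λ a → allV (λ b → not (T a ∧ T b) ∨ reach g a b))

del : ∀ {n} → Adj (suc n) → Fin (suc n) → Adj n
del g v i j = g (punchIn v i) (punchIn v j)

-- Move X = {v}: H = component of v; H - X must be empty or connected.
legal1 : ∀ {n} → Adj (suc n) → Fin (suc n) → Bool
legal1 g v = emptyOrConnected (del g v) (λ i → reach g v (punchIn v i))

-- Move X = {u, v} with v = punchIn u w (so every v ≠ u arises exactly once),
-- u, v adjacent; H = component of u; H - X empty or connected.
legal2 : ∀ {n} → Adj (suc (suc n)) → Fin (suc (suc n)) × Fin (suc n) → Bool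
legal2 g (u , w) =
  g u (punchIn u w) ∧
  emptyOrConnected (del (del g u) w) (λ i → reach g u (punchIn u (punchIn w i)))

pairsV : ∀ n → List (Fin (suc (suc n)) × Fin (suc n))
pairsV n = concatMap (λ u → map (λ w → u , w) (allFin (suc n))) (allFin (suc (suc n)))

mutual
  grundyA : ∀ n → Adj n → ℕ
  grundyA zero    g = 0
  grundyA (suc n) g =
    mex (map (λ v → grundyA n (del g v)) (filterᵇ (legal1 g) (allFin (suc n)))
         ++ pairOpts n g)

  pairOpts : ∀ n → Adj (suc n) → List ℕ
  pairOpts zero    g = []
  pairOpts (suc k) g =
    map (λ p → grundyA k (del (del g (proj₁ p)) (proj₂ p))) (filterᵇ (legal2 g) (pairsV k))

Edges : ℕ → Set
Edges n = List (Fin n × Fin n)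

Graph : Set
Graph = Σ ℕ Edges

toAdj : ∀ {n} → Edges n → Adj n
toAdj E u v = not ⌊ u ≟ v ⌋ ∧
  any (λ e → (⌊ u ≟ proj₁ e ⌋ ∧ ⌊ v ≟ proj₂ e ⌋) ∨ (⌊ u ≟ proj₂ e ⌋ ∧ ⌊ v ≟ proj₁ e ⌋)) E

𝒢 : Graph → ℕ
𝒢 (n , E) = grundyA n (toAdj E)

-- Subdivided stars.  star ls has center and one path of (suc l) vertices
-- for each l in ls (so path lengths ℓᵢ = suc lᵢ ≥ 1).  ∅ is the empty graph.

data Star : Set where
  ∅    : Star
  star : List ℕ → Star

injE : ∀ {n} → Edges n → Edges (suc n)
injE = map (λ e → inject₁ (proj₁ e) , inject₁ (proj₂ e))

addLeaf : ∀ {n} → Edges n → Fin n → Edges (suc n)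
addLeaf {n} E p = (fromℕ n , inject₁ p) ∷ injE E

-- graphs with vertex set Fin (suc m), the center being vertex zero
-- attach a path of k new vertices, starting adjacent to p
pathFrom : ∀ {m} → Edges (suc m) → Fin (suc m) → ℕ → Σ ℕ (λ m′ → Edges (suc m′))
pathFrom {m} E p zero    = m , E
pathFrom {m} E p (suc k) = pathFrom {suc m} (addLeaf E p) (fromℕ (suc m)) k

starG : List ℕ → Σ ℕ (λ m → Edges (suc m))
starG []       = 0 , []
starG (l ∷ ls) = pathFrom (proj₂ (starG ls)) zero (suc l)

graphOf : Star → Graph
graphOf ∅         = 0 , []
graphOf (star ls) = suc (proj₁ (starG ls)) , proj₂ (starG ls)

bistarG : Σ ℕ (λ m → Edges (suc m)) → Σ ℕ (λ m → Edges (suc m)) → Graph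
bistarG (m , E) (m′ , E′) =
  suc m + suc m′ ,
  (zero ↑ˡ suc m′ , suc m ↑ʳ zero)
    ∷ (map (λ e → proj₁ e ↑ˡ suc m′ , proj₂ e ↑ˡ suc m′) E
    ++ map (λ e → suc m ↑ʳ proj₁ e , suc m ↑ʳ proj₂ e) E′)

bistar : Star → Star → Graph
bistar ∅         S′         = graphOf S′
bistar (star ls) ∅          = graphOf (star ls)
bistar (star ls) (star ls′) = bistarG (starG ls) (starG ls′)

_≃_ : Graph → Graph → Set
G₁ ≃ G₂ = 𝒢 G₁ ≡ 𝒢 G₂

_∼₁_ : Star → Star → Set
S ∼₁ S′ = (Ŝ : Star) → bistar S Ŝ ≃ bistar S′ Ŝ

-- The family ℛ : empty graph, and stars S_{2,..,2,1,..,1} with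
-- a paths of 1 vertex and b paths of 2 vertices (determined up to
-- isomorphism by (a , b)).

data ℛ : Set where
  emptyR : ℛ
  starR  : (a b : ℕ) → ℛ

toStar : ℛ → Star
toStar emptyR      = ∅
toStar (starR a b) = star (replicate a 0 ++ replicate b 1)

𝒢ℛ : ℛ → ℕ
𝒢ℛ S = 𝒢 (graphOf (toStar S))

_∼ℛ_ : ℛ → ℛ → Set
S ∼ℛ S′ = toStar S ∼₁ toStar S′

bistarℛ : ℛ → ℛ → Graph
bistarℛ S S′ = bistar (toStar S) (toStar S′)

C1* : ℛ → Set
C1* S = (S ≡ starR 0 0) ⊎ (S ≡ starR 1 1) ⊎ (S ≡ starR 0 3)

C2* : ℛ → Set
C2* S = (S ≡ starR 1 0) ⊎ (S ≡ starR 0 2)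

C□ : ℕ → ℛ → Set
C□ i S = Σ ℕ λ a → Σ ℕ λ b → (S ≡ starR a b) × (𝒢ℛ S ≡ i) × ((b ≡ 1) ⊎ (b ≡ 3))

C2□ C3□ : ℛ → Set
C2□ = C□ 2
C3□ = C□ 3

Cplain : ℕ → ℛ → Set
Cplain i S = (𝒢ℛ S ≡ i) × ¬ C1* S × ¬ C2* S × ¬ C2□ S × ¬ C3□ S

data Cls : Set where
  c0 c1 c1* c2 c2* c2□ c3 c3□ : Cls

_∈C_ : ℛ → Cls → Set
S ∈C c0  = Cplain 0 S
S ∈C c1  = Cplain 1 S
S ∈C c1* = C1* S
S ∈C c2  = Cplain 2 S
S ∈C c2* = C2* S
S ∈C c2□ = C2□ S
S ∈C c3  = Cplain 3 S
S ∈C c3□ = C3□ S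

Exc : ℛ → ℛ → ℕ → Set
Exc S S′ v =
    (C1* S × C1* S′ × v ≡ 2)
  ⊎ (C1* S × C2* S′ × v ≡ 0) ⊎ (C2* S × C1* S′ × v ≡ 0)
  ⊎ (C2* S × C2* S′ × v ≡ 1)
  ⊎ (C2* S × C2□ S′ × v ≡ 1) ⊎ (C2□ S × C2* S′ × v ≡ 1)
  ⊎ (C2* S × C3□ S′ × v ≡ 0) ⊎ (C3□ S × C2* S′ × v ≡ 0)

{-# OPTIONS --safe #-}
module Submission where

-- Write t ◂ s for the tree obtained by joining the roots of t and s, so that bistars are joins of two stars.
-- A move keeps a tree connected, hence it shortens one of the pendant paths, except that a star consisting of
-- its center and at most one more vertex may be deleted as a whole, and that both centers may be deleted when
-- the bistar is a path.  Modulo 3, a path of length ≥ 3 only has additional moves to residues from which one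
-- can move back, so the Grundy value depends only on the numbers a and b of paths on each side that have
-- length 1 and 2 modulo 3.  These enter through the class of the star, which is ultimately periodic in a and b;
-- the mex recursion for the table of values is then a finite verification.

open import Defs
open import Data.Bool using (Bool; true; false; _∧_; _∨_; not; T)
open import Data.Bool.Properties using (T-≡; ∨-zeroʳ)
import Data.Bool.Properties as Bool
open import Data.Empty using (⊥; ⊥-elim)
open import Data.Fin using (Fin; zero; suc; toℕ; fromℕ; fromℕ<; #_; inject₁; punchIn; punchOut; splitAt; _↑ˡ_; _↑ʳ_)
import Data.Fin as Fin
import Data.Fin.Properties as Fin
open import Data.Fin.Relation.Unary.Top using (view; ‵fromℕ; ‵inject₁; view-fromℕ; view-inject₁)
open import Data.List using (List; []; _∷_; map; _++_; length; lookup; foldr; allFin; filterᵇ; replicate)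
open import Data.List.Membership.Propositional using (_∈_; _∉_; find; lose)
open import Data.List.Membership.Propositional.Properties using (∈-map⁺; ∈-map⁻; ∈-++⁺ˡ; ∈-++⁺ʳ; ∈-++⁻; ∈-filter⁺; ∈-filter⁻; ∈-concatMap⁺; ∈-allFin)
import Data.List.Relation.Unary.All as All
import Data.List.Relation.Unary.All.Properties as All
open import Data.List.Relation.Unary.Any using (Any; here; there)
import Data.List.Relation.Unary.Any as Any
import Data.List.Relation.Unary.Any.Properties as Any
open import Data.Maybe using (Maybe; just; nothing)
open import Data.Nat using (ℕ; zero; suc; _+_; _≤_; _<_; z≤n; s≤s)
import Data.Nat as ℕ
open import Data.List.Membership.DecPropositional ℕ._≟_ using (_∈?_)
open import Data.Nat.ListAction using (sum)
import Data.Nat.Properties as ℕ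
open import Data.Product using (Σ; ∃; _,_; _×_; proj₁; proj₂; uncurry)
import Data.Product as Product
open import Data.Sum using (_⊎_; inj₁; inj₂; [_,_])
import Data.Sum as Sum
open import Data.Sum.Properties using (inj₁-injective; inj₂-injective)
import Data.Sum.Properties as Sum
open import Data.Unit using (⊤; tt)
open import Function using (_∘_; const)
open import Function.Bundles using (_⇔_; mk⇔; Equivalence)
open import Relation.Binary.PropositionalEquality using (_≡_; _≢_; refl; sym; trans; cong; cong₂; subst; subst₂)
open import Relation.Nullary using (¬_; yes; no; contradiction)
open import Relation.Nullary.Decidable using (Dec; map′; ¬?; _×-dec_; _⊎-dec_; _→-dec_; T?; ⌊_⌋; toWitness; fromWitness)

-- The relation `∼₁` tests against every subdivided star, so values are needed for paths of all
-- lengths although `ℛ` only has lengths 1 and 2; this is what forces the reduction modulo 3.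
-- Deleting a vertex renumbers the others, hence values are attached to trees, and `Val` ranges over
-- all numberings of a tree. Stars need no recursion of their own: a star with a nonempty path is
-- the join of that path, rooted at its near end, with the rest. The mex is verified from two sides
-- with unequal demands: an option must merely differ from the claimed value, and only smaller
-- values must be produced. Residue changes that exist only for long paths therefore enter the first
-- side through a single inequality, while the second side mostly relies on moves that short paths
-- have too. The exceptions are the deletions possible only for very small stars: a larger star with
-- the same counts has a substitute, a move to class `c0` for the deletion of a whole star, and a
-- move to class `c2*` for the deletion of both centers.

true⇒T : ∀ {b} → b ≡ true → T b
true⇒T = Equivalence.from T-≡

T⇒true : ∀ {b} → T b → b ≡ true
T⇒true = Equivalence.to T-≡

-- The minimum excludant

∈ᵇ⇒∈ : ∀ k xs → (k ∈ᵇ xs) ≡ true → k ∈ xs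
∈ᵇ⇒∈ k xs e = Any.map toWitness (Any.any⁻ _ xs (true⇒T e))

∈⇒∈ᵇ : ∀ {k xs} → k ∈ xs → (k ∈ᵇ xs) ≡ true
∈⇒∈ᵇ k∈xs = T⇒true (Any.any⁺ _ (Any.map fromWitness k∈xs))

mexFrom-unique : ∀ f k {xs m} → m ∉ xs → (∀ j → j < m → j ∈ xs) → k ≤ m → m ≤ k + f → mexFrom f k xs ≡ m
mexFrom-unique zero k m∉ below k≤m m≤k+0 = ℕ.≤-antisym k≤m (subst (_ ≤_) (ℕ.+-identityʳ k) m≤k+0)
mexFrom-unique (suc f) k {xs} {m} m∉ below k≤m m≤k+f with k ∈ᵇ xs in eq
... | true  = mexFrom-unique f (suc k) m∉ below
                (ℕ.≤∧≢⇒< k≤m λ { refl → m∉ (∈ᵇ⇒∈ k xs eq) })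
                (subst (m ≤_) (ℕ.+-suc k f) m≤k+f)
... | false with ℕ.m≤n⇒m<n∨m≡n k≤m
...   | inj₂ k≡m = k≡m
...   | inj₁ k<m with () ← trans (sym eq) (∈⇒∈ᵇ (below k k<m))

-- This shows that the fuel in `mex` suffices. Sending j to its position in `xs` is injective,
-- because looking up that position returns j.
initial-segment-≤-length : ∀ {xs : List ℕ} {m} → (∀ j → j < m → j ∈ xs) → m ≤ length xs
initial-segment-≤-length {xs} {m} below = ℕ.≮⇒≥ λ len<m →
  let index : Fin m → Fin (length xs)
      index i = Any.index (below (toℕ i) (Fin.toℕ<n i))
      i , j , i<j , same = Fin.pigeonhole len<m index
  in ℕ.<⇒≢ i<j (trans (Any.lookup-index (below (toℕ i) (Fin.toℕ<n i)))
       (trans (cong (lookup xs) same) (sym (Any.lookup-index (below (toℕ j) (Fin.toℕ<n j))))))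

mex-unique : ∀ {xs m} → m ∉ xs → (∀ j → j < m → j ∈ xs) → mex xs ≡ m
mex-unique m∉ below = mexFrom-unique _ 0 m∉ below z≤n (ℕ.m≤n⇒m≤1+n (initial-segment-≤-length below))

-- Reachability

allV⁺ : ∀ {n} {p : Fin n → Bool} → (∀ i → p i ≡ true) → allV p ≡ true
allV⁺ all = T⇒true (All.all⁻ _ (All.universal (true⇒T ∘ all) (allFin _)))

allV⁻ : ∀ {n} {p : Fin n → Bool} → allV p ≡ true → ∀ i → p i ≡ true
allV⁻ {n} e i = T⇒true (All.lookup (All.all⁺ _ (allFin n) (true⇒T e)) (∈-allFin i))

anyV⁺ : ∀ {n} {p : Fin n → Bool} i → p i ≡ true → anyV p ≡ true
anyV⁺ i e = T⇒true (Any.any⁺ _ (lose (∈-allFin i) (true⇒T e)))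

anyV⁻ : ∀ {n} {p : Fin n → Bool} → anyV p ≡ true → ∃ λ i → p i ≡ true
anyV⁻ {n} e with i , _ , pi ← find (Any.any⁻ _ (allFin n) (true⇒T e)) = i , T⇒true pi

_⊆_ : ∀ {n} → (Fin n → Bool) → (Fin n → Bool) → Set
S ⊆ S′ = ∀ v → S v ≡ true → S′ v ≡ true

Closed : ∀ {n} → Adj n → (Fin n → Bool) → Set
Closed g S = ∀ u v → S u ≡ true → g u v ≡ true → S v ≡ true

∨⁻ : ∀ a {b} → a ∨ b ≡ true → a ≡ true ⊎ b ≡ true
∨⁻ true  e = inj₁ refl
∨⁻ false e = inj₂ e

∧⁻ : ∀ a {b} → a ∧ b ≡ true → a ≡ true × b ≡ true
∧⁻ true e = refl , e

⊆-closeStep : ∀ {n} (g : Adj n) S → S ⊆ closeStep g S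
⊆-closeStep g S v e rewrite e = refl

edge-closeStep : ∀ {n} (g : Adj n) S u v → S u ≡ true → g u v ≡ true → closeStep g S v ≡ true
edge-closeStep g S u v Su guv =
  trans (cong (S v ∨_) (anyV⁺ u (cong₂ _∧_ Su guv))) (∨-zeroʳ (S v))

⊆-iterate : ∀ {n} k (g : Adj n) S → S ⊆ iterate k g S
⊆-iterate zero    g S v e = e
⊆-iterate (suc k) g S v e = ⊆-iterate k g (closeStep g S) v (⊆-closeStep g S v e)

closeStep-least : ∀ {n} (g : Adj n) {S S′} → Closed g S′ → S ⊆ S′ → closeStep g S ⊆ S′
closeStep-least g {S} closed S⊆S′ v e with ∨⁻ (S v) e
... | inj₁ Sv = S⊆S′ v Sv
... | inj₂ e′ with u , Su∧guv ← anyV⁻ e′ with Su , guv ← ∧⁻ (S u) Su∧guv = closed u v (S⊆S′ u Su) guv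

iterate-least : ∀ {n} k (g : Adj n) {S S′} → Closed g S′ → S ⊆ S′ → iterate k g S ⊆ S′
iterate-least zero    g closed S⊆S′ = S⊆S′
iterate-least (suc k) g closed S⊆S′ = iterate-least k g closed (closeStep-least g closed S⊆S′)

-- Stabilisation of the closure by counting

count : ∀ {n} → (Fin n → Bool) → ℕ
count {zero}  S = 0
count {suc n} S = bit (S zero) + count (S ∘ suc)

bit≤1 : ∀ b → bit b ≤ 1
bit≤1 true  = s≤s z≤n
bit≤1 false = z≤n

bit-mono : ∀ {a b} → (a ≡ true → b ≡ true) → bit a ≤ bit b
bit-mono {true}  a⇒b rewrite a⇒b refl = s≤s z≤n
bit-mono {false} a⇒b = z≤n

count≤n : ∀ {n} (S : Fin n → Bool) → count S ≤ n
count≤n {zero}  S = z≤n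
count≤n {suc n} S = ℕ.+-mono-≤ (bit≤1 (S zero)) (count≤n (S ∘ suc))

count-full : ∀ {n} (S : Fin n → Bool) → n ≤ count S → ∀ v → S v ≡ true
count-full {suc n} S n≤ v with S zero in eq
count-full S n≤ zero    | true  = eq
count-full S (s≤s n≤) (suc v) | true = count-full (S ∘ suc) n≤ v
count-full S n≤ v       | false = contradiction (count≤n (S ∘ suc)) (ℕ.<⇒≱ n≤)

count-mono : ∀ {n} {S S′ : Fin n → Bool} → S ⊆ S′ → count S ≤ count S′
count-mono {zero}  S⊆S′ = z≤n
count-mono {suc n} S⊆S′ = ℕ.+-mono-≤ (bit-mono (S⊆S′ zero)) (count-mono (S⊆S′ ∘ suc))

count-strict : ∀ {n} {S S′ : Fin n → Bool} → S ⊆ S′ → ∀ v → S v ≡ false → S′ v ≡ true → count S < count S′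
count-strict S⊆S′ zero    Sv S′v rewrite Sv | S′v = s≤s (count-mono (S⊆S′ ∘ suc))
count-strict S⊆S′ (suc v) Sv S′v = ℕ.+-mono-≤-< (bit-mono (S⊆S′ zero)) (count-strict (S⊆S′ ∘ suc) v Sv S′v)

-- A step that is not stable adds a vertex, so the size of the set plus the remaining fuel never
-- falls below n; with no fuel left the set is everything. If a step adds nothing, `S` is closed
-- already and contains all later iterates.
iterate-closed : ∀ {n} k (g : Adj n) S → n ≤ count S + k → Closed g (iterate k g S)
iterate-closed zero g S n≤ u v _ _ = count-full S (subst (_ ≤_) (ℕ.+-identityʳ (count S)) n≤) v
iterate-closed {n} (suc k) g S n≤ with Fin.any? (λ v → (S v Bool.≟ false) ×-dec (closeStep g S v Bool.≟ true))
... | yes (v , Sv , S′v) = iterate-closed k g (closeStep g S)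
        (ℕ.≤-trans (subst (n ≤_) (ℕ.+-suc (count S) k) n≤)
          (ℕ.+-monoˡ-≤ k (count-strict (⊆-closeStep g S) v Sv S′v)))
... | no  stable = λ u v Iu guv → ⊆-iterate (suc k) g S v (closed u v (iterate-least (suc k) g closed (λ _ e → e) u Iu) guv)
  where
  closed : Closed g S
  closed u v Su guv with S v in eq
  ... | true  = refl
  ... | false = contradiction (v , eq , edge-closeStep g S u v Su guv) stable

Constant-on-edges : ∀ {n} → Adj n → (Fin n → Bool) → Set
Constant-on-edges g P = ∀ u v → g u v ≡ true → P u ≡ P v

-- Connectedness tested by two-valued functions instead of paths: such functions pull back along
-- vertex maps, so the notion passes to trees and induced subgraphs by composition.
Connected : ∀ {n} → Adj n → Set
Connected g = ∀ P → Constant-on-edges g P → ∀ u v → P u ≡ P v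

reach-sound : ∀ {n} (g : Adj n) {a b} → reach g a b ≡ true → ∀ P → Constant-on-edges g P → P a ≡ P b
reach-sound {n} g {a} {b} e P const = sym (toWitness (true⇒T (iterate-least n g {S′ = λ v → ⌊ P v Bool.≟ P a ⌋} closed start b e)))
  where
  closed : Closed g (λ v → ⌊ P v Bool.≟ P a ⌋)
  closed u v Pu guv = T⇒true (fromWitness (trans (sym (const u v guv)) (toWitness (true⇒T Pu))))
  start : (λ v → ⌊ v Fin.≟ a ⌋) ⊆ (λ v → ⌊ P v Bool.≟ P a ⌋)
  start v v≡a = T⇒true (fromWitness (cong P (toWitness (true⇒T v≡a))))

-- Connectedness is applied to `reach g a` itself: it is closed after n steps, and for a symmetric
-- relation a closed set is constant on edges.
reach-complete : ∀ {n} {g : Adj n} → (∀ u v → g u v ≡ g v u) → Connected g → ∀ a b → reach g a b ≡ true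
reach-complete {n} {g} g-sym conn a b = trans (conn (reach g a) constant b a) reach-refl
  where
  S₀ : Fin n → Bool
  S₀ v = ⌊ v Fin.≟ a ⌋
  a∈S₀ : S₀ a ≡ true
  a∈S₀ = T⇒true (fromWitness refl)
  reach-refl : reach g a a ≡ true
  reach-refl = ⊆-iterate n g S₀ a a∈S₀
  closed : Closed g (reach g a)
  closed = iterate-closed n g S₀ (ℕ.m≤n+m n (count S₀))
  constant : Constant-on-edges g (reach g a)
  constant u v guv with reach g a u in eu | reach g a v in ev
  ... | true  | true  = refl
  ... | false | false = refl
  ... | true  | false = trans (sym (closed u v eu guv)) ev
  ... | false | true  = trans (sym eu) (closed v u ev (trans (g-sym v u) guv))

-- Rooted trees

infixr 5 _◂_

-- t ◂ s joins the roots of t and s by an edge and keeps the root of s.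
data Tree : Set where
  •   : Tree
  _◂_ : Tree → Tree → Tree

V : Tree → Set
V •       = ⊤
V (t ◂ s) = V t ⊎ V s

root : ∀ t → V t
root •       = tt
root (t ◂ s) = inj₂ (root s)

isRoot : ∀ t → V t → Bool
isRoot •       _        = true
isRoot (t ◂ s) (inj₁ _) = false
isRoot (t ◂ s) (inj₂ v) = isRoot s v

adj : ∀ t → V t → V t → Bool
adj •       _        _        = false
adj (t ◂ s) (inj₁ u) (inj₁ v) = adj t u v
adj (t ◂ s) (inj₁ u) (inj₂ v) = isRoot t u ∧ isRoot s v
adj (t ◂ s) (inj₂ u) (inj₁ v) = isRoot t v ∧ isRoot s u
adj (t ◂ s) (inj₂ u) (inj₂ v) = adj s u v

Vᵐ : Maybe Tree → Set
Vᵐ (just t) = V t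
Vᵐ nothing  = ⊥

adjᵐ : ∀ o → Vᵐ o → Vᵐ o → Bool
adjᵐ (just t) = adj t

isRoot-root : ∀ t → isRoot t (root t) ≡ true
isRoot-root •       = refl
isRoot-root (t ◂ s) = isRoot-root s

isRoot⇒≡root : ∀ t v → isRoot t v ≡ true → v ≡ root t
isRoot⇒≡root •       tt       e = refl
isRoot⇒≡root (t ◂ s) (inj₂ v) e = cong inj₂ (isRoot⇒≡root s v e)

adj-sym : ∀ t u v → adj t u v ≡ adj t v u
adj-sym •       u        v        = refl
adj-sym (t ◂ s) (inj₁ u) (inj₁ v) = adj-sym t u v
adj-sym (t ◂ s) (inj₁ u) (inj₂ v) = refl
adj-sym (t ◂ s) (inj₂ u) (inj₁ v) = refl
adj-sym (t ◂ s) (inj₂ u) (inj₂ v) = adj-sym s u v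

adj-irrefl : ∀ t v → adj t v v ≡ false
adj-irrefl •       v        = refl
adj-irrefl (t ◂ s) (inj₁ v) = adj-irrefl t v
adj-irrefl (t ◂ s) (inj₂ v) = adj-irrefl s v

tree-connected : ∀ t (P : V t → Bool) → (∀ u v → adj t u v ≡ true → P u ≡ P v) → ∀ v → P v ≡ P (root t)
tree-connected •       P const tt       = refl
tree-connected (t ◂ s) P const (inj₂ v) = tree-connected s (P ∘ inj₂) (λ u v → const (inj₂ u) (inj₂ v)) v
tree-connected (t ◂ s) P const (inj₁ v) =
  trans (tree-connected t (P ∘ inj₁) (λ u v → const (inj₁ u) (inj₁ v)) v)
        (const (inj₁ (root t)) (inj₂ (root s)) (cong₂ _∧_ (isRoot-root t) (isRoot-root s)))

-- Deleting vertices

-- An isomorphism of `o` onto the subgraph of `t` induced outside `xs`. Since `Tree` has no empty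
-- tree, `nothing` stands for the empty graph.
record Del (t : Tree) (xs : List (V t)) (o : Maybe Tree) : Set where
  field
    emb           : Vᵐ o → V t
    emb-injective : ∀ {x y} → emb x ≡ emb y → x ≡ y
    emb-avoids    : ∀ x → emb x ∉ xs
    emb-covers    : ∀ w → w ∉ xs → ∃ λ x → emb x ≡ w
    emb-adj       : ∀ x y → adjᵐ o x y ≡ adj t (emb x) (emb y)
open Del

-- The edge added by `◂` is determined by the roots, so a deletion inside one side extends to the
-- join only if it preserves them.
RootDel : (t : Tree) → List (V t) → Tree → Set
RootDel t xs t′ = Σ (Del t xs (just t′)) λ d → ∀ x → isRoot t (emb d x) ≡ isRoot t′ x

∉₁ : ∀ {A : Set} {w x : A} → w ≢ x → w ∉ x ∷ []
∉₁ w≢x (here e) = w≢x e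

∉₂ : ∀ {A : Set} {w x y : A} → w ≢ x → w ≢ y → w ∉ x ∷ y ∷ []
∉₂ w≢x w≢y (here e)         = w≢x e
∉₂ w≢x w≢y (there (here e)) = w≢y e

inj₁∈map⁻ : ∀ {A B : Set} {x : A} {xs} → inj₁ {B = B} x ∈ map inj₁ xs → x ∈ xs
inj₁∈map⁻ m with _ , x∈ , refl ← ∈-map⁻ inj₁ m = x∈

inj₂∈map⁻ : ∀ {A B : Set} {x : B} {xs} → inj₂ {A = A} x ∈ map inj₂ xs → x ∈ xs
inj₂∈map⁻ m with _ , x∈ , refl ← ∈-map⁻ inj₂ m = x∈

inj₂∉map-inj₁ : ∀ {A B : Set} {x : B} {xs : List A} → inj₂ x ∉ map inj₁ xs
inj₂∉map-inj₁ m with _ , _ , () ← ∈-map⁻ inj₁ m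

inj₁∉map-inj₂ : ∀ {A B : Set} {x : A} {xs : List B} → inj₁ x ∉ map inj₂ xs
inj₁∉map-inj₂ m with _ , _ , () ← ∈-map⁻ inj₂ m

del-left : ∀ {t t′ s xs} → RootDel t xs t′ → RootDel (t ◂ s) (map inj₁ xs) (t′ ◂ s)
del-left (d , isRoot-emb) = record
  { emb           = [ inj₁ ∘ emb d , inj₂ ]
  ; emb-injective = λ { {inj₁ x} {inj₁ y} e → cong inj₁ (emb-injective d (inj₁-injective e))
                      ; {inj₂ x} {inj₂ y} e → cong inj₂ (inj₂-injective e) }
  ; emb-avoids    = λ { (inj₁ x) → emb-avoids d x ∘ inj₁∈map⁻ ; (inj₂ y) → inj₂∉map-inj₁ }
  ; emb-covers    = λ { (inj₁ w) w∉ → let x , e = emb-covers d w (w∉ ∘ ∈-map⁺ inj₁) in inj₁ x , cong inj₁ e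
                      ; (inj₂ w) w∉ → inj₂ w , refl }
  ; emb-adj       = λ { (inj₁ x) (inj₁ y) → emb-adj d x y
                      ; (inj₁ x) (inj₂ y) → cong (_∧ _) (sym (isRoot-emb x))
                      ; (inj₂ x) (inj₁ y) → cong (_∧ _) (sym (isRoot-emb y))
                      ; (inj₂ x) (inj₂ y) → refl }
  } , λ { (inj₁ x) → refl ; (inj₂ y) → refl }

del-right : ∀ {t s s′ xs} → RootDel s xs s′ → RootDel (t ◂ s) (map inj₂ xs) (t ◂ s′)
del-right (d , isRoot-emb) = record
  { emb           = [ inj₁ , inj₂ ∘ emb d ]
  ; emb-injective = λ { {inj₁ x} {inj₁ y} e → cong inj₁ (inj₁-injective e)
                      ; {inj₂ x} {inj₂ y} e → cong inj₂ (emb-injective d (inj₂-injective e)) }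
  ; emb-avoids    = λ { (inj₁ x) → inj₁∉map-inj₂ ; (inj₂ y) → emb-avoids d y ∘ inj₂∈map⁻ }
  ; emb-covers    = λ { (inj₁ w) w∉ → inj₁ w , refl
                      ; (inj₂ w) w∉ → let x , e = emb-covers d w (w∉ ∘ ∈-map⁺ inj₂) in inj₂ x , cong inj₂ e }
  ; emb-adj       = λ { (inj₁ x) (inj₁ y) → refl
                      ; (inj₁ x) (inj₂ y) → cong (_ ∧_) (sym (isRoot-emb y))
                      ; (inj₂ x) (inj₁ y) → cong (_ ∧_) (sym (isRoot-emb x))
                      ; (inj₂ x) (inj₂ y) → emb-adj d x y }
  } , λ { (inj₁ x) → refl ; (inj₂ y) → isRoot-emb y }

drop-left : ∀ {t s xs} → (∀ v → inj₁ v ∈ xs) → (∀ v → inj₂ v ∉ xs) → RootDel (t ◂ s) xs s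
drop-left in₁ out₂ = record
  { emb           = inj₂
  ; emb-injective = inj₂-injective
  ; emb-avoids    = out₂
  ; emb-covers    = λ { (inj₁ w) w∉ → contradiction (in₁ w) w∉ ; (inj₂ w) _ → w , refl }
  ; emb-adj       = λ _ _ → refl
  } , λ _ → refl

drop-right : ∀ {t s xs} → (∀ v → inj₁ v ∉ xs) → (∀ v → inj₂ v ∈ xs) → Del (t ◂ s) xs (just t)
drop-right out₁ in₂ = record
  { emb           = inj₁
  ; emb-injective = inj₁-injective
  ; emb-avoids    = out₁
  ; emb-covers    = λ { (inj₂ w) w∉ → contradiction (in₂ w) w∉ ; (inj₁ w) _ → w , refl }
  ; emb-adj       = λ _ _ → refl
  }

drop-all : ∀ {t xs} → (∀ v → v ∈ xs) → Del t xs nothing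
drop-all all = record
  { emb = λ () ; emb-injective = λ { {()} } ; emb-avoids = λ ()
  ; emb-covers = λ w w∉ → contradiction (all w) w∉ ; emb-adj = λ () }

-- Only the set of deleted vertices matters, so `zs` may list the members of `xs` and of the image
-- of `ys` in any order; `drop-topʳ-del` needs the second deletion listed first.
del-∘ : ∀ {t t′ o xs ys zs} (d : Del t xs (just t′)) (d′ : Del t′ ys o) →
        (∀ w → w ∈ zs → w ∈ xs ⊎ w ∈ map (emb d) ys) → (∀ {w} → w ∈ xs → w ∈ zs) → (∀ {y} → y ∈ ys → emb d y ∈ zs) →
        Del t zs o
del-∘ {ys = ys} d d′ split xs⊆ ys⊆ = record
  { emb           = emb d ∘ emb d′
  ; emb-injective = emb-injective d′ ∘ emb-injective d
  ; emb-avoids    = λ x x∈ → [ emb-avoids d _ , (λ m → emb-avoids d′ x (pull m)) ] (split _ x∈)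
  ; emb-covers    = λ w w∉ → let y , y≡ = emb-covers d w (w∉ ∘ xs⊆)
                                 x , x≡ = emb-covers d′ y (λ y∈ → w∉ (subst (_∈ _) y≡ (ys⊆ y∈)))
                             in x , trans (cong (emb d) x≡) y≡
  ; emb-adj       = λ x y → trans (emb-adj d′ x y) (emb-adj d _ _)
  }
  where
  pull : ∀ {x} → emb d x ∈ map (emb d) ys → x ∈ ys
  pull m with y , y∈ , e ← ∈-map⁻ (emb d) m = subst (_∈ ys) (sym (emb-injective d e)) y∈

∈-swap : ∀ {A : Set} {u v w : A} → w ∈ u ∷ v ∷ [] → w ∈ v ∷ u ∷ []
∈-swap (here e)         = there (here e)
∈-swap (there (here e)) = here e

del-swap : ∀ {t u v o} → Del t (u ∷ v ∷ []) o → Del t (v ∷ u ∷ []) o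
del-swap d = record
  { emb = emb d ; emb-injective = emb-injective d ; emb-avoids = λ x → emb-avoids d x ∘ ∈-swap
  ; emb-covers = λ w w∉ → emb-covers d w (w∉ ∘ ∈-swap) ; emb-adj = emb-adj d }

-- Moves

infix 4 _↝_ _⇒_

-- The moves that keep the root. Connectedness then forces the deleted set to contain everything
-- below it, so it is a whole branch with one or two vertices.
data _↝_ : Tree → Tree → Set where
  leaf  : ∀ {s} → • ◂ s ↝ s
  pair  : ∀ {s} → (• ◂ •) ◂ s ↝ s
  left  : ∀ {t t′ s} → t ↝ t′ → t ◂ s ↝ t′ ◂ s
  right : ∀ {t s s′} → s ↝ s′ → t ◂ s ↝ t ◂ s′

-- Once the root is deleted, what remains must lie in a single branch. `drop-edge` and `drop-topʳ`
-- are the same move for the two orders in which the branches of the root can be joined.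
data _⇒_ : Tree → Maybe Tree → Set where
  keep-root    : ∀ {t t′} → t ↝ t′ → t ⇒ just t′
  vertex       : • ⇒ nothing
  edge         : • ◂ • ⇒ nothing
  drop-root    : ∀ {t} → t ◂ • ⇒ just t
  drop-edge    : ∀ {t} → t ◂ • ◂ • ⇒ just t
  drop-topˡ    : ∀ {t} → (t ◂ •) ◂ • ⇒ just t
  drop-topʳ    : ∀ {t} → • ◂ t ◂ • ⇒ just t

data Shape (t : Tree) : List (V t) → Set where
  one : ∀ x → Shape t (x ∷ [])
  two : ∀ x y → adj t x y ≡ true → Shape t (x ∷ y ∷ [])

shape-left : ∀ {t s xs} → Shape t xs → Shape (t ◂ s) (map inj₁ xs)
shape-left (one x)     = one (inj₁ x)
shape-left (two x y e) = two (inj₁ x) (inj₁ y) e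

shape-right : ∀ {t s xs} → Shape s xs → Shape (t ◂ s) (map inj₂ xs)
shape-right (one x)     = one (inj₂ x)
shape-right (two x y e) = two (inj₂ x) (inj₂ y) e

leaf-del : ∀ {s} → RootDel (• ◂ s) (inj₁ tt ∷ []) s
leaf-del = drop-left (λ _ → here refl) (λ _ → ∉₁ λ ())

pair-del : ∀ {s} → RootDel ((• ◂ •) ◂ s) (inj₁ (inj₂ tt) ∷ inj₁ (inj₁ tt) ∷ []) s
pair-del = drop-left (λ { (inj₁ tt) → there (here refl) ; (inj₂ tt) → here refl })
                     (λ _ → ∉₂ (λ ()) (λ ()))

drop-root-del : ∀ {t} → Del (t ◂ •) (inj₂ tt ∷ []) (just t)
drop-root-del = drop-right (λ _ → ∉₁ λ ()) (λ _ → here refl)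

drop-edge-del : ∀ {t} → Del (t ◂ • ◂ •) (inj₂ (inj₂ tt) ∷ inj₂ (inj₁ tt) ∷ []) (just t)
drop-edge-del = drop-right (λ _ → ∉₂ (λ ()) (λ ()))
                           (λ { (inj₁ tt) → there (here refl) ; (inj₂ tt) → here refl })

drop-topˡ-del : ∀ {t} → Del ((t ◂ •) ◂ •) (inj₂ tt ∷ inj₁ (inj₂ tt) ∷ []) (just t)
drop-topˡ-del = del-∘ drop-root-del drop-root-del
  (λ { _ (here e) → inj₁ (here e) ; _ (there e) → inj₂ e }) (λ { (here e) → here e }) (λ { (here refl) → there (here refl) })

drop-topʳ-del : ∀ {t} → Del (• ◂ t ◂ •) (inj₂ (inj₂ tt) ∷ inj₁ tt ∷ []) (just t)
drop-topʳ-del = del-∘ (proj₁ leaf-del) drop-root-del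
  (λ { _ (here e) → inj₂ (here e) ; _ (there e) → inj₁ e }) (λ { (here e) → there (here e) }) (λ { (here refl) → here refl })

↝⇒del : ∀ {t t′} → t ↝ t′ → ∃ λ xs → Shape t xs × RootDel t xs t′
↝⇒del leaf      = _ , one _ , leaf-del
↝⇒del pair      = _ , two _ _ refl , pair-del
↝⇒del (left m)  = let _ , sh , d = ↝⇒del m in _ , shape-left sh , del-left d
↝⇒del (right m) = let _ , sh , d = ↝⇒del m in _ , shape-right sh , del-right d

⇒⇒del : ∀ {t o} → t ⇒ o → ∃ λ xs → Shape t xs × Del t xs o
⇒⇒del (keep-root m) = let _ , sh , d = ↝⇒del m in _ , sh , proj₁ d
⇒⇒del vertex    = _ , one tt , drop-all (λ _ → here refl)
⇒⇒del edge      = _ , two (inj₁ tt) (inj₂ tt) refl , drop-all (λ { (inj₁ tt) → here refl ; (inj₂ tt) → there (here refl) })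
⇒⇒del drop-root = _ , one _ , drop-root-del
⇒⇒del drop-edge = _ , two _ _ refl , drop-edge-del
⇒⇒del drop-topˡ = _ , two _ _ refl , drop-topˡ-del
⇒⇒del drop-topʳ = _ , two _ _ refl , drop-topʳ-del

-- Deletions that leave the tree connected

-- The tree minus `xs` is empty or connected, phrased with functions on the whole tree so that they
-- can be extended over a join.
Conn : (t : Tree) → List (V t) → Set
Conn t xs = (P : V t → Bool) → (∀ u v → u ∉ xs → v ∉ xs → adj t u v ≡ true → P u ≡ P v) →
            ∀ u v → u ∉ xs → v ∉ xs → P u ≡ P v

conn-swap : ∀ {t u v} → Conn t (u ∷ v ∷ []) → Conn t (v ∷ u ∷ [])
conn-swap conn P const a b a∉ b∉ =
  conn P (λ c d c∉ d∉ → const c d (c∉ ∘ ∈-swap) (d∉ ∘ ∈-swap)) a b (a∉ ∘ ∈-swap) (b∉ ∘ ∈-swap)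

-- Collapsing s to the root of t maps edges of t ◂ s to edges or points of t.
conn-left : ∀ t s {xs} → Conn (t ◂ s) (map inj₁ xs) → Conn t xs
conn-left t s {xs} conn P const u v u∉ v∉ = conn P′ const′ (inj₁ u) (inj₁ v) (u∉ ∘ inj₁∈map⁻) (v∉ ∘ inj₁∈map⁻)
  where
  P′ : V (t ◂ s) → Bool
  P′ = [ P , (λ _ → P (root t)) ]
  const′ : ∀ u v → u ∉ map inj₁ xs → v ∉ map inj₁ xs → adj (t ◂ s) u v ≡ true → P′ u ≡ P′ v
  const′ (inj₁ u) (inj₁ v) u∉ v∉ e = const u v (u∉ ∘ ∈-map⁺ inj₁) (v∉ ∘ ∈-map⁺ inj₁) e
  const′ (inj₁ u) (inj₂ v) u∉ v∉ e = cong P (isRoot⇒≡root t u (proj₁ (∧⁻ _ e)))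
  const′ (inj₂ u) (inj₁ v) u∉ v∉ e = cong P (sym (isRoot⇒≡root t v (proj₁ (∧⁻ _ e))))
  const′ (inj₂ u) (inj₂ v) u∉ v∉ e = refl

conn-right : ∀ t s {xs} → Conn (t ◂ s) (map inj₂ xs) → Conn s xs
conn-right t s {xs} conn P const u v u∉ v∉ = conn P′ const′ (inj₂ u) (inj₂ v) (u∉ ∘ inj₂∈map⁻) (v∉ ∘ inj₂∈map⁻)
  where
  P′ : V (t ◂ s) → Bool
  P′ = [ (λ _ → P (root s)) , P ]
  const′ : ∀ u v → u ∉ map inj₂ xs → v ∉ map inj₂ xs → adj (t ◂ s) u v ≡ true → P′ u ≡ P′ v
  const′ (inj₁ u) (inj₁ v) u∉ v∉ e = refl
  const′ (inj₁ u) (inj₂ v) u∉ v∉ e = cong P (sym (isRoot⇒≡root s v (proj₂ (∧⁻ _ e))))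
  const′ (inj₂ u) (inj₁ v) u∉ v∉ e = cong P (isRoot⇒≡root s u (proj₂ (∧⁻ (isRoot t v) e)))
  const′ (inj₂ u) (inj₂ v) u∉ v∉ e = const u v (u∉ ∘ ∈-map⁺ inj₂) (v∉ ∘ ∈-map⁺ inj₂) e

-- A separation of `t` minus `X`, normalised to be `false` at the root, even if the root lies in
-- `X`. Whatever is later joined at the root can be put on that side, which lets cuts propagate
-- outwards.
record Cut (t : Tree) (X : V t → Set) : Set where
  constructor mkCut
  field
    side  : V t → Bool
    root-side : side (root t) ≡ false
    no-crossing : ∀ u v → ¬ X u → ¬ X v → adj t u v ≡ true → side u ≡ side v
open Cut

-- With the root gone, nothing links the branch `p` to the rest of `p ◂ q`.
cut-here : ∀ p q {X} → X (inj₂ (root q)) → Cut (p ◂ q) X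
cut-here p q {X} Xr = mkCut [ const true , const false ] refl
  λ { (inj₁ u) (inj₁ v) _ _ _ → refl
    ; (inj₁ u) (inj₂ v) _ ¬Xv e → contradiction (subst (X ∘ inj₂) (sym (isRoot⇒≡root q v (proj₂ (∧⁻ _ e)))) Xr) ¬Xv
    ; (inj₂ u) (inj₁ v) ¬Xu _ e → contradiction (subst (X ∘ inj₂) (sym (isRoot⇒≡root q u (proj₂ (∧⁻ (isRoot p v) e)))) Xr) ¬Xu
    ; (inj₂ u) (inj₂ v) _ _ _ → refl }

cut-left : ∀ t s {X} → Cut t (X ∘ inj₁) → Cut (t ◂ s) X
cut-left t s c = mkCut [ side c , const false ] refl
  λ { (inj₁ u) (inj₁ v) ¬Xu ¬Xv e → no-crossing c u v ¬Xu ¬Xv e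
    ; (inj₁ u) (inj₂ v) _ _ e → trans (cong (side c) (isRoot⇒≡root t u (proj₁ (∧⁻ _ e)))) (root-side c)
    ; (inj₂ u) (inj₁ v) _ _ e → sym (trans (cong (side c) (isRoot⇒≡root t v (proj₁ (∧⁻ _ e)))) (root-side c))
    ; (inj₂ u) (inj₂ v) _ _ _ → refl }

cut-right : ∀ t s {X} → Cut s (X ∘ inj₂) → Cut (t ◂ s) X
cut-right t s c = mkCut [ const false , side c ] (root-side c)
  λ { (inj₁ u) (inj₁ v) _ _ _ → refl
    ; (inj₁ u) (inj₂ v) _ _ e → sym (trans (cong (side c) (isRoot⇒≡root s v (proj₂ (∧⁻ _ e)))) (root-side c))
    ; (inj₂ u) (inj₁ v) _ _ e → trans (cong (side c) (isRoot⇒≡root s u (proj₂ (∧⁻ (isRoot t v) e)))) (root-side c)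
    ; (inj₂ u) (inj₂ v) ¬Xu ¬Xv e → no-crossing c u v ¬Xu ¬Xv e }

cut⇒¬conn : ∀ {t xs} (c : Cut t (_∈ xs)) u v → side c u ≡ true → side c v ≡ false → u ∉ xs → v ∉ xs → ¬ Conn t xs
cut⇒¬conn c u v Pu Pv u∉ v∉ conn
  with () ← trans (sym Pu) (trans (conn (side c) (no-crossing c) u v u∉ v∉) Pv)

-- Classification of connected deletions

inner-vertex-move : ∀ t v → isRoot t v ≡ false → Conn t (v ∷ []) → ∃ λ t′ → t ↝ t′ × RootDel t (v ∷ []) t′
inner-vertex-move (t ◂ s) (inj₂ v) e conn =
  let s′ , m , d = inner-vertex-move s v e (conn-right t s conn) in t ◂ s′ , right m , del-right d
inner-vertex-move (t ◂ s) (inj₁ v) _ conn with isRoot t v in e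
... | false = let t′ , m , d = inner-vertex-move t v e (conn-left t s conn) in t′ ◂ s , left m , del-left d
inner-vertex-move (• ◂ s) (inj₁ v) _ conn | true = s , leaf , leaf-del
inner-vertex-move ((p ◂ q) ◂ s) (inj₁ (inj₂ v)) _ conn | true with refl ← isRoot⇒≡root q v e =
  ⊥-elim (cut⇒¬conn (cut-left (p ◂ q) s (cut-here p q (here refl)))
    (inj₁ (inj₁ (root p))) (inj₂ (root s)) refl refl (∉₁ λ ()) (∉₁ λ ()) conn)

root-vertex-move : ∀ t → Conn t (root t ∷ []) → ∃ λ o → t ⇒ o × Del t (root t ∷ []) o
root-vertex-move •       conn = nothing , vertex , drop-all (λ _ → here refl)
root-vertex-move (t ◂ •) conn = just t , drop-root , drop-root-del
root-vertex-move (t ◂ p ◂ q) conn =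
  ⊥-elim (cut⇒¬conn (cut-right t (p ◂ q) (cut-here p q (here refl)))
    (inj₂ (inj₁ (root p))) (inj₁ (root t)) refl refl (∉₁ λ ()) (∉₁ λ ()) conn)

vertex-move : ∀ t v → Conn t (v ∷ []) → ∃ λ o → t ⇒ o × Del t (v ∷ []) o
vertex-move t v conn with isRoot t v in e
... | false = let t′ , m , d = inner-vertex-move t v e conn in just t′ , keep-root m , proj₁ d
... | true with refl ← isRoot⇒≡root t v e = root-vertex-move t conn

-- The deleted pair contains a child of the root of `t ◂ s`. As that root stays, any other vertex of
-- the branch `t` would be cut off from it, so the branch is a single edge.
child-pair-move : ∀ t s v → adj t (root t) v ≡ true → Conn (t ◂ s) (inj₁ (root t) ∷ inj₁ v ∷ []) →
                  t ◂ s ↝ s × RootDel (t ◂ s) (inj₁ (root t) ∷ inj₁ v ∷ []) s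
child-pair-move (p ◂ q) s (inj₂ v) e conn =
  ⊥-elim (cut⇒¬conn (cut-left (p ◂ q) s (cut-here p q (here refl)))
    (inj₁ (inj₁ (root p))) (inj₂ (root s)) refl refl
    (∉₂ (λ ()) (λ ())) (∉₂ (λ ()) (λ ())) conn)
child-pair-move (p ◂ q) s (inj₁ v) e conn with refl ← isRoot⇒≡root p v (proj₁ (∧⁻ _ e)) with p | q
... | • | •     = pair , pair-del
... | a ◂ b | q =
  ⊥-elim (cut⇒¬conn (cut-left _ s (cut-left (a ◂ b) q (cut-here a b (there (here refl)))))
    (inj₁ (inj₁ (inj₁ (root a)))) (inj₂ (root s)) refl refl
    (∉₂ (λ ()) (λ ())) (∉₂ (λ ()) (λ ())) conn)
... | • | a ◂ b =
  ⊥-elim (cut⇒¬conn (cut-left _ s (cut-right • (a ◂ b) (cut-here a b (here refl))))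
    (inj₁ (inj₂ (inj₁ (root a)))) (inj₂ (root s)) refl refl
    (∉₂ (λ ()) (λ ())) (∉₂ (λ ()) (λ ())) conn)

inner-pair-move : ∀ t u v → isRoot t u ≡ false → isRoot t v ≡ false → adj t u v ≡ true → Conn t (u ∷ v ∷ []) →
                  ∃ λ t′ → t ↝ t′ × RootDel t (u ∷ v ∷ []) t′
inner-pair-move (t ◂ s) (inj₂ u) (inj₂ v) eu ev e conn =
  let s′ , m , d = inner-pair-move s u v eu ev e (conn-right t s conn) in t ◂ s′ , right m , del-right d
inner-pair-move (t ◂ s) (inj₁ u) (inj₂ v) eu ev e conn with () ← trans (sym ev) (proj₂ (∧⁻ (isRoot t u) e))
inner-pair-move (t ◂ s) (inj₂ u) (inj₁ v) eu ev e conn with () ← trans (sym eu) (proj₂ (∧⁻ (isRoot t v) e))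
inner-pair-move (t ◂ s) (inj₁ u) (inj₁ v) _ _ e conn with isRoot t u in eu | isRoot t v in ev
... | false | false =
  let t′ , m , d = inner-pair-move t u v eu ev e (conn-left t s conn) in t′ ◂ s , left m , del-left d
... | true  | _    with refl ← isRoot⇒≡root t u eu = s , child-pair-move t s v e conn
... | false | true with refl ← isRoot⇒≡root t v ev =
  let m , d , r = child-pair-move t s u (trans (adj-sym t (root t) u) e) (conn-swap conn) in s , m , del-swap d , r

-- Deleting the root and a neighbour may leave only one piece. Each shape outside the constructors
-- of `_⇒_` leaves two, and the cut exhibits one vertex in each.
root-pair-move : ∀ t v → adj t (root t) v ≡ true → Conn t (root t ∷ v ∷ []) →
                 ∃ λ o → t ⇒ o × Del t (root t ∷ v ∷ []) o
root-pair-move (t ◂ s) (inj₁ v) e conn with refl ← isRoot⇒≡root t v (proj₁ (∧⁻ _ e)) with t | s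
... | • | •             = nothing , edge , drop-all (λ { (inj₁ tt) → there (here refl) ; (inj₂ tt) → here refl })
... | a ◂ • | •         = just a , drop-topˡ , drop-topˡ-del
... | • | p ◂ •         = just p , drop-topʳ , drop-topʳ-del
... | a ◂ c ◂ d | •     =
  ⊥-elim (cut⇒¬conn (cut-left (a ◂ c ◂ d) • (cut-here a (c ◂ d) (there (here refl))))
    (inj₁ (inj₁ (root a))) (inj₁ (inj₂ (inj₁ (root c)))) refl refl
    (∉₂ (λ ()) (λ ())) (∉₂ (λ ()) (λ ())) conn)
... | • | p ◂ c ◂ d     =
  ⊥-elim (cut⇒¬conn (cut-right • (p ◂ c ◂ d) (cut-here p (c ◂ d) (here refl)))
    (inj₂ (inj₁ (root p))) (inj₂ (inj₂ (inj₁ (root c)))) refl refl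
    (∉₂ (λ ()) (λ ())) (∉₂ (λ ()) (λ ())) conn)
... | a ◂ b | p ◂ q     =
  ⊥-elim (cut⇒¬conn (cut-left (a ◂ b) (p ◂ q) (cut-here a b (there (here refl))))
    (inj₁ (inj₁ (root a))) (inj₂ (inj₁ (root p))) refl refl
    (∉₂ (λ ()) (λ ())) (∉₂ (λ ()) (λ ())) conn)
root-pair-move (t ◂ p ◂ q) (inj₂ (inj₂ v)) e conn =
  ⊥-elim (cut⇒¬conn (cut-right t (p ◂ q) (cut-here p q (here refl)))
    (inj₂ (inj₁ (root p))) (inj₁ (root t)) refl refl
    (∉₂ (λ ()) (λ ())) (∉₂ (λ ()) (λ ())) conn)
root-pair-move (t ◂ p ◂ q) (inj₂ (inj₁ v)) e conn with refl ← isRoot⇒≡root p v (proj₁ (∧⁻ _ e)) with p | q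
... | • | •     = just t , drop-edge , drop-edge-del
... | a ◂ b | q =
  ⊥-elim (cut⇒¬conn (cut-right t _ (cut-left (a ◂ b) q (cut-here a b (there (here refl)))))
    (inj₂ (inj₁ (inj₁ (root a)))) (inj₁ (root t)) refl refl
    (∉₂ (λ ()) (λ ())) (∉₂ (λ ()) (λ ())) conn)
... | • | a ◂ b =
  ⊥-elim (cut⇒¬conn (cut-right t _ (cut-right • (a ◂ b) (cut-here a b (here refl))))
    (inj₂ (inj₂ (inj₁ (root a)))) (inj₁ (root t)) refl refl
    (∉₂ (λ ()) (λ ())) (∉₂ (λ ()) (λ ())) conn)

pair-move : ∀ t u v → adj t u v ≡ true → Conn t (u ∷ v ∷ []) → ∃ λ o → t ⇒ o × Del t (u ∷ v ∷ []) o
pair-move t u v e conn with isRoot t u in eu | isRoot t v in ev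
... | false | false = let t′ , m , d = inner-pair-move t u v eu ev e conn in just t′ , keep-root m , proj₁ d
... | true  | _    with refl ← isRoot⇒≡root t u eu = root-pair-move t v e conn
... | false | true with refl ← isRoot⇒≡root t v ev =
  let o , m , d = root-pair-move t u (trans (adj-sym t (root t) u) e) (conn-swap conn) in o , m , del-swap d

-- Graphs isomorphic to trees

record Real {n} (g : Adj n) (o : Maybe Tree) : Set where
  field
    to      : Fin n → Vᵐ o
    from    : Vᵐ o → Fin n
    from-to : ∀ i → from (to i) ≡ i
    to-from : ∀ v → to (from v) ≡ v
    to-adj  : ∀ i j → g i j ≡ adjᵐ o (to i) (to j)
open Real

real-connected : ∀ {n} {g : Adj n} o → Real g o → Connected g
real-connected nothing  r P const u v = ⊥-elim (to r u)
real-connected (just t) r P const u v = trans (to-root u) (sym (to-root v))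
  where
  const′ : ∀ x y → adj t x y ≡ true → P (from r x) ≡ P (from r y)
  const′ x y e = const _ _ (trans (to-adj r _ _) (trans (cong₂ (adj t) (to-from r x) (to-from r y)) e))
  to-root : ∀ i → P i ≡ P (from r (root t))
  to-root i = trans (cong P (sym (from-to r i))) (tree-connected t (P ∘ from r) const′ (to r i))

real-sym : ∀ {n} {g : Adj n} o → Real g o → ∀ u v → g u v ≡ g v u
real-sym nothing  r u v = ⊥-elim (to r u)
real-sym (just t) r u v = trans (to-adj r u v) (trans (adj-sym t _ _) (sym (to-adj r v u)))

real-reach : ∀ {n} {g : Adj n} o → Real g o → ∀ a b → reach g a b ≡ true
real-reach o r = reach-complete (real-sym o r) (real-connected o r)

emptyOrConnected⁺ : ∀ {n} (g : Adj n) S → (∀ a b → reach g a b ≡ true) → emptyOrConnected g S ≡ true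
emptyOrConnected⁺ g S all = allV⁺ λ a → allV⁺ λ b → 
  subst (λ c → not (S a ∧ S b) ∨ c ≡ true) (sym (all a b)) (∨-zeroʳ (not (S a ∧ S b)))

emptyOrConnected⁻ : ∀ {n} (g : Adj n) S → (∀ a → S a ≡ true) → emptyOrConnected g S ≡ true → ∀ a b → reach g a b ≡ true
emptyOrConnected⁻ g S full e a b with c ← allV⁻ (allV⁻ e a) b rewrite full a | full b = c

-- `h` enumerates the surviving vertices. This covers one and two applications of `punchIn` at once,
-- so both kinds of deletion share `restrict-real` and `restrict-conn`.
record Complement {n k} (t : Tree) (to : Fin n → V t) (xs : List (V t)) (h : Fin k → Fin n) : Set where
  field
    inj    : ∀ {i j} → h i ≡ h j → i ≡ j
    avoids : ∀ i → to (h i) ∉ xs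
    covers : ∀ j → to j ∉ xs → ∃ λ i → h i ≡ j
open Complement

module _ {n k} {g : Adj n} {t : Tree} {xs : List (V t)} {h : Fin k → Fin n}
         (r : Real g (just t)) (c : Complement t (to r) xs h) where

  private
    from∉ : ∀ {v} → v ∉ xs → to r (from r v) ∉ xs
    from∉ {v} v∉ e = v∉ (subst (_∈ xs) (to-from r v) e)

  restrict-real : ∀ {o} → Del t xs o → Real (λ i j → g (h i) (h j)) o
  restrict-real d = record
    { to      = λ i → proj₁ (cover i)
    ; from    = λ x → proj₁ (back x)
    ; from-to = λ i → inj c (trans (proj₂ (back _)) (trans (cong (from r) (proj₂ (cover i))) (from-to r (h i))))
    ; to-from = λ x → emb-injective d (trans (proj₂ (cover _)) (trans (cong (to r) (proj₂ (back x))) (to-from r _)))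
    ; to-adj  = λ i j → trans (to-adj r (h i) (h j))
                  (trans (sym (cong₂ (adj t) (proj₂ (cover i)) (proj₂ (cover j)))) (sym (emb-adj d _ _)))
    }
    where
    cover : ∀ i → ∃ λ x → emb d x ≡ to r (h i)
    cover i = emb-covers d (to r (h i)) (avoids c i)
    back : ∀ x → ∃ λ i → h i ≡ from r (emb d x)
    back x = covers c _ (from∉ (emb-avoids d x))

  restrict-conn : (∀ a b → reach (λ i j → g (h i) (h j)) a b ≡ true) → Conn t xs
  restrict-conn all P const u v u∉ v∉
    with i , hi ← covers c _ (from∉ u∉) | j , hj ← covers c _ (from∉ v∉) =
    trans (sym (P-h u hi)) (trans (reach-sound _ (all i j) (P ∘ to r ∘ h) const′) (P-h v hj))
    where
    P-h : ∀ u {i} → h i ≡ from r u → P (to r (h i)) ≡ P u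
    P-h u e = cong P (trans (cong (to r) e) (to-from r u))
    const′ : ∀ i j → g (h i) (h j) ≡ true → P (to r (h i)) ≡ P (to r (h j))
    const′ i j e = const _ _ (avoids c i) (avoids c j) (trans (sym (to-adj r (h i) (h j))) e)

to-injective : ∀ {n} {g : Adj n} {o} (r : Real g o) {i j} → to r i ≡ to r j → i ≡ j
to-injective r {i} {j} e = trans (sym (from-to r i)) (trans (cong (from r) e) (from-to r j))

punchIn-covers : ∀ {n} (v j : Fin (suc n)) → j ≢ v → ∃ λ i → punchIn v i ≡ j
punchIn-covers v j j≢v = punchOut (j≢v ∘ sym) , Fin.punchIn-punchOut (j≢v ∘ sym)

complement₁ : ∀ {n} {g : Adj (suc n)} {t} (r : Real g (just t)) v →
              Complement t (to r) (to r v ∷ []) (punchIn v)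
complement₁ r v = record
  { inj    = Fin.punchIn-injective v _ _
  ; avoids = λ i → ∉₁ λ e → Fin.punchInᵢ≢i v i (to-injective r e)
  ; covers = λ j j∉ → punchIn-covers v j λ j≡v → j∉ (here (cong (to r) j≡v))
  }

complement₂ : ∀ {n} {g : Adj (suc (suc n))} {t} (r : Real g (just t)) u w →
              Complement t (to r) (to r u ∷ to r (punchIn u w) ∷ []) (punchIn u ∘ punchIn w)
complement₂ r u w = record
  { inj    = Fin.punchIn-injective w _ _ ∘ Fin.punchIn-injective u _ _
  ; avoids = λ i → ∉₂ (λ e → Fin.punchInᵢ≢i u _ (to-injective r e))
                      (λ e → Fin.punchInᵢ≢i w i (Fin.punchIn-injective u _ _ (to-injective r e)))
  ; covers = λ j j∉ →
      let i , i≡ = punchIn-covers u j (λ j≡u → j∉ (here (cong (to r) j≡u)))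
          k , k≡ = punchIn-covers w i (λ i≡w → j∉ (there (here (cong (to r) (trans (sym i≡) (cong (punchIn u) i≡w))))))
      in k , trans (cong (punchIn u) k≡) i≡
  }

legal1⇒move : ∀ {n} {g : Adj (suc n)} {t} → Real g (just t) → ∀ v → legal1 g v ≡ true →
              ∃ λ o → t ⇒ o × Real (del g v) o
legal1⇒move {g = g} {t} r v e =
  let c = complement₁ r v
      o , m , d = vertex-move t (to r v)
        (restrict-conn r c (emptyOrConnected⁻ (del g v) _ (λ i → real-reach (just t) r v (punchIn v i)) e))
  in o , m , restrict-real r c d

legal2⇒move : ∀ {n} {g : Adj (suc (suc n))} {t} → Real g (just t) → ∀ u w → legal2 g (u , w) ≡ true →
              ∃ λ o → t ⇒ o × Real (del (del g u) w) o
legal2⇒move {g = g} {t} r u w e =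
  let c = complement₂ r u w
      guw , e′ = ∧⁻ (g u (punchIn u w)) e
      o , m , d = pair-move t (to r u) (to r (punchIn u w)) (trans (sym (to-adj r u (punchIn u w))) guw)
        (restrict-conn r c (emptyOrConnected⁻ (del (del g u) w) _ (λ i → real-reach (just t) r u _) e′))
  in o , m , restrict-real r c d

-- Grundy values

-- Quantifying over all graphs isomorphic to the tree makes the statement stable under the
-- renumbering caused by each deletion.
Val : Maybe Tree → ℕ → Set
Val o m = ∀ {n} {g : Adj n} → Real g o → grundyA n g ≡ m

val-nothing : Val nothing 0
val-nothing {zero}  r = refl
val-nothing {suc n} r = ⊥-elim (to r zero)

options : ∀ n → Adj (suc n) → List ℕ
options n g = map (λ v → grundyA n (del g v)) (filterᵇ (legal1 g) (allFin (suc n))) ++ pairOpts n g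

option⇒move : ∀ n {g : Adj (suc n)} {t k} → Real g (just t) → k ∈ options n g →
              ∃ λ o → t ⇒ o × (∀ {m} → Val o m → k ≡ m)
option⇒move n {g} r k∈ with ∈-++⁻ (map (λ v → grundyA n (del g v)) (filterᵇ (legal1 g) (allFin (suc n)))) k∈
... | inj₁ k∈₁ with v , v∈ , refl ← ∈-map⁻ (λ v → grundyA n (del g v)) k∈₁ =
  let _ , legal = ∈-filter⁻ (T? ∘ legal1 g) v∈
      o , m , r′ = legal1⇒move r v (T⇒true legal)
  in o , m , λ val → val r′
option⇒move (suc n) {g} r k∈ | inj₂ k∈₂
  with (u , w) , uw∈ , refl ← ∈-map⁻ (λ p → grundyA n (del (del g (proj₁ p)) (proj₂ p))) k∈₂ =
  let _ , legal = ∈-filter⁻ (T? ∘ legal2 g) uw∈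
      o , m , r′ = legal2⇒move r u w (T⇒true legal)
  in o , m , λ val → val r′

∈-pairsV : ∀ {n} u w → (u , w) ∈ pairsV n
∈-pairsV u w = ∈-concatMap⁺ (λ u → map (u ,_) (allFin _)) (lose (∈-allFin u) (∈-map⁺ (u ,_) (∈-allFin w)))

move⇒option : ∀ n {g : Adj (suc n)} {t o k} → Real g (just t) → t ⇒ o → Val o k → k ∈ options n g
move⇒option n {g} {t} {o} {k} r m val with ⇒⇒del m
... | _ , one x , d = subst (_∈ options n g) (val r′) (∈-++⁺ˡ (∈-map⁺ (λ v → grundyA n (del g v))
        (∈-filter⁺ (T? ∘ legal1 g) (∈-allFin v) (true⇒T (emptyOrConnected⁺ (del g v) (reach g v ∘ punchIn v) (real-reach o r′))))))
  where
  v = from r x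
  r′ : Real (del g v) o
  r′ = restrict-real r (complement₁ r v) (subst (λ y → Del t (y ∷ []) o) (sym (to-from r x)) d)
... | _ , two x y adj-xy , d = pair-case n r (from r x) (from r y) (to-from r x) (to-from r y)
  where
  x≢y : x ≢ y
  x≢y refl with () ← trans (sym adj-xy) (adj-irrefl t x)
  -- `pairOpts` is empty on one vertex, so `n` is split; there the two ends would coincide, against
  -- irreflexivity.
  pair-case : ∀ n {g : Adj (suc n)} (r : Real g (just t)) u v → to r u ≡ x → to r v ≡ y → k ∈ options n g
  pair-case zero    r zero zero refl refl = contradiction refl x≢y
  pair-case (suc n) {g} r u v refl refl with punchIn-covers u v (λ { refl → x≢y refl })
  ... | w , refl = subst (_∈ options (suc n) g) (val r′) (∈-++⁺ʳ (map _ (filterᵇ (legal1 g) (allFin _)))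
          (∈-map⁺ (λ p → grundyA n (del (del g (proj₁ p)) (proj₂ p)))
            (∈-filter⁺ (T? ∘ legal2 g) (∈-pairsV u w)
              (true⇒T (cong₂ _∧_ (trans (to-adj r u v) adj-xy)
                                 (emptyOrConnected⁺ (del (del g u) w) (reach g u ∘ punchIn u ∘ punchIn w) (real-reach o r′)))))))
    where
    r′ : Real (del (del g u) w) o
    r′ = restrict-real r (complement₂ r u w) d

-- All later use of the mex goes through this form: an option must only avoid `m`, and exact values
-- must be realised only below `m`.
val-mex : ∀ {t m} → (∀ {o} → t ⇒ o → ∃ λ k → Val o k × k ≢ m) →
          (∀ k → k < m → ∃ λ o → t ⇒ o × Val o k) → Val (just t) m
val-mex {t} other below {zero}  r with () ← from r (root t)
val-mex {t} {m} other below {suc n} {g} r = mex-unique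
  (λ m∈ → let _ , move , determined = option⇒move n r m∈
              _ , val , k≢m = other move
          in k≢m (sym (determined val)))
  (λ k k<m → let _ , move , val = below k k<m in move⇒option n r move val)

-- Paths and stars

-- path l has l + 1 vertices and is rooted at an end.
path : ℕ → Tree
path zero    = •
path (suc l) = path l ◂ •

attach : ℕ → Tree → Tree
attach zero    s = s
attach (suc l) s = path l ◂ s

-- Here, unlike in Defs, an entry n stands for a path of n ≥ 0 vertices.
starT : List ℕ → Tree
starT = foldr attach •

path≡starT : ∀ l → path l ≡ starT (l ∷ [])
path≡starT zero    = refl
path≡starT (suc l) = refl

infix 4 _⊳_

-- Because entries may drop to 0, a move never changes the length of the list: it lowers one entry
-- by 1 or 2.
data _⊳_ : List ℕ → List ℕ → Set where
  dec₁ : ∀ {n ns} → suc n ∷ ns ⊳ n ∷ ns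
  dec₂ : ∀ {n ns} → suc (suc n) ∷ ns ⊳ n ∷ ns
  skip : ∀ {n ns ns′} → ns ⊳ ns′ → n ∷ ns ⊳ n ∷ ns′

path-dec₁ : ∀ l → path (suc l) ↝ path l
path-dec₁ zero    = leaf
path-dec₁ (suc l) = left (path-dec₁ l)

path-dec₂ : ∀ l → path (suc (suc l)) ↝ path l
path-dec₂ zero    = pair
path-dec₂ (suc l) = left (path-dec₂ l)

path-move : ∀ l {t} → path l ↝ t → ∃ λ m → t ≡ path m × (l ≡ suc m ⊎ l ≡ suc (suc m))
path-move (suc zero) leaf = 0 , refl , inj₁ refl
path-move (suc (suc zero)) pair = 0 , refl , inj₂ refl
path-move (suc (suc l)) (left m) with path-move (suc l) m
... | k , refl , inj₁ refl = suc k , refl , inj₁ refl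
... | k , refl , inj₂ refl = suc k , refl , inj₂ refl

attach-tail : ∀ n {s s′} → s ↝ s′ → attach n s ↝ attach n s′
attach-tail zero    m = m
attach-tail (suc l) m = right m

⊳⇒↝ : ∀ {ns ns′} → ns ⊳ ns′ → starT ns ↝ starT ns′
⊳⇒↝ (dec₁ {zero})  = leaf
⊳⇒↝ (dec₁ {suc l}) = left (path-dec₁ l)
⊳⇒↝ (dec₂ {zero})  = pair
⊳⇒↝ (dec₂ {suc l}) = left (path-dec₂ l)
⊳⇒↝ (skip {n} d)   = attach-tail n (⊳⇒↝ d)

attach-move : ∀ l {s t} → path l ◂ s ↝ t →
              (∃ λ m → t ≡ attach m s × (l ≡ m ⊎ l ≡ suc m)) ⊎ ∃ λ s′ → t ≡ path l ◂ s′ × s ↝ s′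
attach-move zero leaf = inj₁ (0 , refl , inj₁ refl)
attach-move (suc zero) pair = inj₁ (0 , refl , inj₂ refl)
attach-move l (right m) = inj₂ (_ , refl , m)
attach-move l (left m) with path-move l m
... | k , refl , inj₁ refl = inj₁ (suc k , refl , inj₁ refl)
... | k , refl , inj₂ refl = inj₁ (suc k , refl , inj₂ refl)

↝⇒⊳ : ∀ ns {t} → starT ns ↝ t → ∃ λ ns′ → ns ⊳ ns′ × t ≡ starT ns′
↝⇒⊳ (zero ∷ ns) m = let ns′ , d , e = ↝⇒⊳ ns m in 0 ∷ ns′ , skip d , e
↝⇒⊳ (suc l ∷ ns) m with attach-move l m
... | inj₁ (k , refl , inj₁ refl) = k ∷ ns , dec₁ , refl
... | inj₁ (k , refl , inj₂ refl) = k ∷ ns , dec₂ , refl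
... | inj₂ (_ , refl , m′) with ns′ , d , refl ← ↝⇒⊳ ns m′ = suc l ∷ ns′ , skip d , refl

⊳-sum : ∀ {ns ns′} → ns ⊳ ns′ → sum ns′ < sum ns
⊳-sum dec₁ = ℕ.≤-refl
⊳-sum dec₂ = s≤s (ℕ.n≤1+n _)
⊳-sum (skip {n} d) = ℕ.+-monoʳ-< n (⊳-sum d)

-- Path lengths modulo 3

data ℤ₃ : Set where
  r0 r1 r2 : ℤ₃

next : ℤ₃ → ℤ₃
next r0 = r1
next r1 = r2
next r2 = r0

res : ℕ → ℤ₃
res zero    = r0
res (suc n) = next (res n)

add : ℤ₃ → ℕ × ℕ → ℕ × ℕ
add r0 x       = x
add r1 (a , b) = suc a , b
add r2 (a , b) = a , suc b

counts : List ℕ → ℕ × ℕ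
counts = foldr (add ∘ res) (0 , 0)

add-comm : ∀ r r′ x → add r (add r′ x) ≡ add r′ (add r x)
add-comm r0 r′ x = refl
add-comm r1 r0 x = refl
add-comm r1 r1 x = refl
add-comm r1 r2 x = refl
add-comm r2 r0 x = refl
add-comm r2 r1 x = refl
add-comm r2 r2 x = refl

add-cancel : ∀ r {x y} → add r x ≡ add r y → x ≡ y
add-cancel r0 refl = refl
add-cancel r1 refl = refl
add-cancel r2 refl = refl

next-≢ : ∀ r → next r ≢ r
next-≢ r0 ()
next-≢ r1 ()
next-≢ r2 ()

next²-≢ : ∀ r → next (next r) ≢ r
next²-≢ r0 ()
next²-≢ r1 ()
next²-≢ r2 ()

-- `x` counts the paths that are not touched. Lowering a length by 1 or 2 always changes its residue
-- modulo 3, hence `r ≢ r′`.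
⊳-counts : ∀ {ns ns′} → ns ⊳ ns′ →
             ∃ λ x → ∃ λ r → ∃ λ r′ → r ≢ r′ × counts ns ≡ add r x × counts ns′ ≡ add r′ x
⊳-counts (dec₁ {n} {ns}) = counts ns , _ , _ , next-≢ (res n) , refl , refl
⊳-counts (dec₂ {n} {ns}) = counts ns , _ , _ , next²-≢ (res n) , refl , refl
⊳-counts (skip {n} d) =
  let x , r , r′ , r≢r′ , e , e′ = ⊳-counts d
  in add (res n) x , r , r′ , r≢r′ ,
     trans (cong (add (res n)) e) (add-comm (res n) r x) , trans (cong (add (res n)) e′) (add-comm (res n) r′ x)

Reaches : List ℕ → ℕ × ℕ → Set
Reaches ns x = ∃ λ ns′ → ns ⊳ ns′ × counts ns′ ≡ x

skip-reaches : ∀ {n ns x} → Reaches ns x → Reaches (n ∷ ns) (add (res n) x)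
skip-reaches {n} (ns′ , d , e) = n ∷ ns′ , skip d , cong (add (res n)) e

reach-r1 : ∀ ns {a b} → counts ns ≡ (suc a , b) → Reaches ns (a , b)
reach-r1 (n ∷ ns) e with res n in eq
reach-r1 (n ∷ ns) e | r0 with ns′ , d , e′ ← reach-r1 ns e = n ∷ ns′ , skip d , cong₂ add eq e′
reach-r1 (suc n ∷ ns) e | r1 with res n in eq′
... | r0 = n ∷ ns , dec₁ , trans (cong (λ r → add r (counts ns)) eq′) (add-cancel r1 e)
reach-r1 (n ∷ ns) {b = suc b} e | r2 with ns′ , d , e′ ← reach-r1 ns {b = b} (add-cancel r2 e) =
  n ∷ ns′ , skip d , cong₂ add eq e′

-- A path of residue 2 has two vertices to spare: removing both leaves residue 0, removing one
-- leaves residue 1.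
reach-r2 : ∀ ns {a b} → counts ns ≡ (a , suc b) → Reaches ns (a , b) × Reaches ns (suc a , b)
reach-r2 (n ∷ ns) e with res n in eq
reach-r2 (n ∷ ns) e | r0 with (ns′ , d , e′) , (ns″ , d′ , e″) ← reach-r2 ns e =
  (n ∷ ns′ , skip d , cong₂ add eq e′) , (n ∷ ns″ , skip d′ , cong₂ add eq e″)
reach-r2 (n ∷ ns) {suc a} e | r1 with (ns′ , d , e′) , (ns″ , d′ , e″) ← reach-r2 ns {a} (add-cancel r1 e) =
  (n ∷ ns′ , skip d , cong₂ add eq e′) , (n ∷ ns″ , skip d′ , cong₂ add eq e″)
reach-r2 (suc zero ∷ ns) e | r2 with () ← eq
reach-r2 (suc (suc n) ∷ ns) e | r2 with res n in eq′
... | r0 = (n ∷ ns , dec₂ , trans (cong (λ r → add r (counts ns)) eq′) (add-cancel r2 e))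
         , (suc n ∷ ns , dec₁ , trans (cong (λ r → add (next r) (counts ns)) eq′) (cong (add r1) (add-cancel r2 e)))

-- All lengths are multiples of 3. If some path is nonempty, it has at least three vertices, and
-- removing two or one of them leaves residue 1 or 2.
reach-r0 : ∀ ns → counts ns ≡ (0 , 0) → starT ns ≡ • ⊎ (Reaches ns (1 , 0) × Reaches ns (0 , 1))
reach-r0 [] e = inj₁ refl
reach-r0 (zero ∷ ns) e with reach-r0 ns e
... | inj₁ s≡•     = inj₁ s≡•
... | inj₂ (r , r′) = inj₂ (skip-reaches {0} r , skip-reaches {0} r′)
reach-r0 (suc zero ∷ ns) ()
reach-r0 (suc (suc n) ∷ ns) e with res n in eq
... | r1 = inj₂ ( (n ∷ ns , dec₂ , trans (cong (λ r → add r (counts ns)) eq) (cong (add r1) e))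
                , (suc n ∷ ns , dec₁ , trans (cong (λ r → add (next r) (counts ns)) eq) (cong (add r2) e)))

-- Beyond a single edge, some path has at least three vertices. Removing two from it leads to (2 ,
-- 0) if its length is divisible by 3; if it is the path of residue 1, to (0 , 1). Both counts have
-- class `c0`, as needed to replace the deletion of the whole star.
reach-1,0 : ∀ ns → counts ns ≡ (1 , 0) → starT ns ≡ • ◂ • ⊎ Reaches ns (2 , 0) ⊎ Reaches ns (0 , 1)
reach-1,0 (zero ∷ ns) e with reach-1,0 ns e
... | inj₁ s≡        = inj₁ s≡
... | inj₂ (inj₁ r)  = inj₂ (inj₁ (skip-reaches {0} r))
... | inj₂ (inj₂ r)  = inj₂ (inj₂ (skip-reaches {0} r))
reach-1,0 (suc zero ∷ ns) e with reach-r0 ns (add-cancel r1 e)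
... | inj₁ s≡• = inj₁ (cong (• ◂_) s≡•)
... | inj₂ (r , _) = inj₂ (inj₁ (skip-reaches {1} r))
reach-1,0 (suc (suc n) ∷ ns) e with res n in eq
reach-1,0 (suc (suc n) ∷ ns) e | r1 = inj₂ (inj₁ (n ∷ ns , dec₂ , trans (cong (λ r → add r (counts ns)) eq) (cong (add r1) e)))
reach-1,0 (suc (suc n) ∷ ns) e | r2 = inj₂ (inj₂ (n ∷ ns , dec₂ , trans (cong (λ r → add r (counts ns)) eq) (cong (add r2) (add-cancel r1 e))))

-- The classes

val : Cls → ℕ
val c0  = 0
val c1  = 1
val c1* = 1
val c2  = 2
val c2* = 2
val c2□ = 2
val c3  = 3
val c3□ = 3

bival : Cls → Cls → ℕ
bival c1* c1* = 2
bival c1* c2* = 0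
bival c2* c1* = 0
bival c2* c2* = 1
bival c2* c2□ = 1
bival c2□ c2* = 1
bival c2* c3□ = 0
bival c3□ c2* = 0
bival c   c′  = val c ⊕ val c′

-- The class of the star with a paths of 1 vertex and b paths of 2 vertices
-- depends only on the parity of a from 2 on, and on that of b from 4 on.
capᵃ capᵇ : ℕ → ℕ
capᵃ (suc (suc (suc (suc a)))) = capᵃ (suc (suc a))
capᵃ a                         = a
capᵇ (suc (suc (suc (suc (suc (suc b)))))) = capᵇ (suc (suc (suc (suc b))))
capᵇ b                                     = b

-- A solution of the mex recursion that is certified rather than derived: `distinct` compares the
-- residues of one path, `attains` produces the smaller values.
table : ℕ → ℕ → Cls
table 0 0 = c1*
table 1 0 = c2*
table 2 0 = c0
table _ 0 = c1
table 0 1 = c0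
table 1 1 = c1*
table 2 1 = c2□
table _ 1 = c3□
table 0 2 = c2*
table 1 2 = c0
table 2 2 = c1
table _ 2 = c0
table 0 3 = c1*
table 1 3 = c2□
table 2 3 = c3□
table _ 3 = c2□
table 0 4 = c0
table 1 4 = c1
table 2 4 = c0
table _ 4 = c1
table 0 _ = c2
table 1 _ = c3
table 2 _ = c2
table _ _ = c3

cls : ℕ → ℕ → Cls
cls a b = table (capᵃ a) (capᵇ b)

class : List ℕ → Cls
class ns = uncurry cls (counts ns)

-- Finite verification of the table

allCls : List Cls
allCls = c0 ∷ c1 ∷ c1* ∷ c2 ∷ c2* ∷ c2□ ∷ c3 ∷ c3□ ∷ []

∈-allCls : ∀ c → c ∈ allCls
∈-allCls c0  = here refl
∈-allCls c1  = there (here refl)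
∈-allCls c1* = there (there (here refl))
∈-allCls c2  = there (there (there (here refl)))
∈-allCls c2* = there (there (there (there (here refl))))
∈-allCls c2□ = there (there (there (there (there (here refl)))))
∈-allCls c3  = there (there (there (there (there (there (here refl))))))
∈-allCls c3□ = there (there (there (there (there (there (there (here refl)))))))

∀Cls? : {P : Cls → Set} → (∀ c → Dec (P c)) → Dec (∀ c → P c)
∀Cls? P? = map′ (λ all c → All.lookup all (∈-allCls c)) (λ f → All.universal f allCls) (All.all? P? allCls)

bival-comm : ∀ c d → bival c d ≡ bival d c
bival-comm = toWitness {a? = ∀Cls? λ c → ∀Cls? λ d → bival c d ℕ.≟ bival d c} _

bival-c0 : ∀ d → bival c0 d ≡ val d
bival-c0 = toWitness {a? = ∀Cls? λ d → bival c0 d ℕ.≟ val d} _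

-- The one-vertex star has class `c1*` and the edge has class `c2*`. Either can be deleted whole
-- from a bistar, so the value of the star left over must differ from that of the bistar.
val≢bival-c1* : ∀ d → val d ≢ bival c1* d
val≢bival-c1* = toWitness {a? = ∀Cls? λ d → ¬? (val d ℕ.≟ bival c1* d)} _

val≢bival-c2* : ∀ d → val d ≢ bival c2* d
val≢bival-c2* = toWitness {a? = ∀Cls? λ d → ¬? (val d ℕ.≟ bival c2* d)} _

-- `cls` has period two from a = 2 and b = 4 on, but `moves` also looks one step back, so
-- periodicity is only asked from 3 and 5 on. This leaves a up to 4 and b up to 6 to check.
periodic : (P : ℕ → ℕ → Set) → (∀ a b → P (3 + a) b → P (5 + a) b) → (∀ a b → P a (5 + b) → P a (7 + b)) →
           (∀ (i : Fin 5) (j : Fin 7) → P (toℕ i) (toℕ j)) → ∀ a b → P a b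
periodic P stepᵃ stepᵇ base = go
  where
  column : ∀ (i : Fin 5) b → P (toℕ i) b
  column i 0 = base i (# 0)
  column i 1 = base i (# 1)
  column i 2 = base i (# 2)
  column i 3 = base i (# 3)
  column i 4 = base i (# 4)
  column i 5 = base i (# 5)
  column i 6 = base i (# 6)
  column i (suc (suc n@(suc (suc (suc (suc (suc b))))))) = stepᵇ _ b (column i n)
  go : ∀ a b → P a b
  go 0 b = column (# 0) b
  go 1 b = column (# 1) b
  go 2 b = column (# 2) b
  go 3 b = column (# 3) b
  go 4 b = column (# 4) b
  go (suc (suc n@(suc (suc (suc a))))) b = stepᵃ a b (go n b)

-- The three counts are those obtained by adding a path of residue 0, 1 or 2 to the same star.
Distinct : ℕ → ℕ → Set
Distinct a b = ∀ d → bival (cls a b) d ≢ bival (cls (suc a) b) d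
                   × bival (cls a b) d ≢ bival (cls a (suc b)) d
                   × bival (cls (suc a) b) d ≢ bival (cls a (suc b)) d

distinct? : ∀ a b → Dec (Distinct a b)
distinct? a b = ∀Cls? λ d → ¬? (_ ℕ.≟ _) ×-dec ¬? (_ ℕ.≟ _) ×-dec ¬? (_ ℕ.≟ _)

distinct : ∀ a b → Distinct a b
-- The induction steps are identities since `capᵃ` and `capᵇ` reduce the shifted counts by
-- computation.
distinct = periodic Distinct (λ _ _ p → p) (λ _ _ p → p)
  (toWitness {a? = Fin.all? λ i → Fin.all? λ j → distinct? (toℕ i) (toℕ j)} _)

add-distinct : ∀ {r r′} x d → r ≢ r′ → bival (uncurry cls (add r x)) d ≢ bival (uncurry cls (add r′ x)) d
add-distinct {r0} {r0} _ _ r≢r′ = contradiction refl r≢r′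
add-distinct {r0} {r1} (a , b) d _ = proj₁ (distinct a b d)
add-distinct {r0} {r2} (a , b) d _ = proj₁ (proj₂ (distinct a b d))
add-distinct {r1} {r0} (a , b) d _ = proj₁ (distinct a b d) ∘ sym
add-distinct {r1} {r1} _ _ r≢r′ = contradiction refl r≢r′
add-distinct {r1} {r2} (a , b) d _ = proj₂ (proj₂ (distinct a b d))
add-distinct {r2} {r0} (a , b) d _ = proj₁ (proj₂ (distinct a b d)) ∘ sym
add-distinct {r2} {r1} (a , b) d _ = proj₂ (proj₂ (distinct a b d)) ∘ sym
add-distinct {r2} {r2} _ _ r≢r′ = contradiction refl r≢r′

⊳-distinct : ∀ {ns ns′} → ns ⊳ ns′ → ∀ d → bival (class ns′) d ≢ bival (class ns) d
⊳-distinct m d with x , r , r′ , r≢r′ , e , e′ ← ⊳-counts m rewrite e | e′ = add-distinct x d (r≢r′ ∘ sym)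

-- The shortenings kept are the residue changes open to every star with these counts: 1 to 0, 2 to 0
-- and 2 to 1. The others require a path with at least three vertices.
shorten₁ shorten₂ drop-star moves : ℕ → ℕ → List Cls
shorten₁ zero    b = []
shorten₁ (suc a) b = cls a b ∷ []
shorten₂ a zero    = []
shorten₂ a (suc b) = cls a b ∷ cls (suc a) b ∷ []
-- A star with at most one vertex besides its center can be deleted as a whole,
-- which has the same effect as turning it into a star of class c0.
drop-star 0 0 = c0 ∷ []
drop-star 1 0 = c0 ∷ []
drop-star _ _ = []
moves a b = shorten₁ a b ++ shorten₂ a b ++ drop-star a b

moves-stepᵃ : ∀ a b → moves (3 + a) b ≡ moves (5 + a) b
moves-stepᵃ a zero    = refl
moves-stepᵃ a (suc b) = refl

moves-stepᵇ : ∀ a b → moves a (5 + b) ≡ moves a (7 + b)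
moves-stepᵇ zero          b = refl
moves-stepᵇ (suc zero)    b = refl
moves-stepᵇ (suc (suc a)) b = refl

-- `Z` marks the case in which both stars have counts zero; the value 0 is then supplied separately,
-- by `option-zero`.
Attained : Cls → List Cls → Cls → List Cls → Set → Set
Attained c cs d ds Z = ∀ (k : Fin (bival c d)) →
  toℕ k ∈ map (λ c′ → bival c′ d) cs ⊎ toℕ k ∈ map (bival c) ds ⊎ (Z × toℕ k ≡ 0)

attained-resp : ∀ c {cs cs′} d {ds ds′ Z Z′} → cs ≡ cs′ → ds ≡ ds′ → (Z → Z′) → Attained c cs d ds Z → Attained c cs′ d ds′ Z′
attained-resp c d refl refl f att k with att k
... | inj₁ p = inj₁ p
... | inj₂ (inj₁ p) = inj₂ (inj₁ p)
... | inj₂ (inj₂ (z , e)) = inj₂ (inj₂ (f z , e))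

Attains : ℕ → ℕ → ℕ → ℕ → Set
Attains a b a′ b′ = Attained (cls a b) (moves a b) (cls a′ b′) (moves a′ b′)
                             ((a ≡ 0 × b ≡ 0) × (a′ ≡ 0 × b′ ≡ 0))

attains? : ∀ a b a′ b′ → Dec (Attains a b a′ b′)
attains? a b a′ b′ = Fin.all? λ k → (_ ∈? _) ⊎-dec ((_ ∈? _) ⊎-dec
  (((a ℕ.≟ 0) ×-dec (b ℕ.≟ 0)) ×-dec ((a′ ℕ.≟ 0) ×-dec (b′ ℕ.≟ 0))) ×-dec (toℕ k ℕ.≟ 0))

abstract
  -- Periodicity is used for the counts of the first star with the partner arbitrary, then for those
  -- of the partner, leaving a grid of 35 times 35 cases.
  attains : ∀ a b a′ b′ → Attains a b a′ b′
  attains = periodic (λ a b → ∀ a′ b′ → Attains a b a′ b′)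
    (λ a b p a′ b′ → attained-resp (cls (3 + a) b) (cls a′ b′) (moves-stepᵃ a b) refl (λ { ((() , _) , _) }) (p a′ b′))
    (λ a b p a′ b′ → attained-resp (cls a (5 + b)) (cls a′ b′) (moves-stepᵇ a b) refl (λ { ((_ , ()) , _) }) (p a′ b′))
    λ i j → periodic (Attains (toℕ i) (toℕ j))
      (λ a b → attained-resp (cls (toℕ i) (toℕ j)) (cls (3 + a) b) refl (moves-stepᵃ a b) (λ { (_ , () , _) }))
      (λ a b → attained-resp (cls (toℕ i) (toℕ j)) (cls a (5 + b)) refl (moves-stepᵇ a b) (λ { (_ , _ , ()) }))
      (grid i j)
    where
    grid : ∀ (i : Fin 5) (j : Fin 7) (i′ : Fin 5) (j′ : Fin 7) → Attains (toℕ i) (toℕ j) (toℕ i′) (toℕ j′)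
    grid = toWitness {a? = Fin.all? λ i → Fin.all? λ j → Fin.all? λ i′ → Fin.all? λ j′ →
                           attains? (toℕ i) (toℕ j) (toℕ i′) (toℕ j′)} _

-- Moves in bistars

-- The shapes are given by equations because `t` and `s` will be of the form `starT ns`, on which
-- one cannot match directly. When just the two centers are deleted and something remains, one star
-- is a bare center and the other has a single branch.
data JoinMove (t s : Tree) : Maybe Tree → Set where
  inˡ      : ∀ {t′} → t ↝ t′ → JoinMove t s (just (t′ ◂ s))
  inʳ      : ∀ {s′} → s ↝ s′ → JoinMove t s (just (t ◂ s′))
  dropˡ    : t ≡ • ⊎ t ≡ • ◂ • → JoinMove t s (just s)
  dropʳ    : s ≡ • ⊎ s ≡ • ◂ • → JoinMove t s (just t)
  drop-both : t ≡ • → s ≡ • → JoinMove t s nothing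
  centersˡ : ∀ {p} → t ≡ p ◂ • → s ≡ • → JoinMove t s (just p)
  centersʳ : ∀ {p} → t ≡ • → s ≡ p ◂ • → JoinMove t s (just p)

⇒⇒join : ∀ {t s o} → t ◂ s ⇒ o → JoinMove t s o
⇒⇒join (keep-root leaf)      = dropˡ (inj₁ refl)
⇒⇒join (keep-root pair)      = dropˡ (inj₂ refl)
⇒⇒join (keep-root (left m))  = inˡ m
⇒⇒join (keep-root (right m)) = inʳ m
⇒⇒join edge                  = drop-both refl refl
⇒⇒join drop-root             = dropʳ (inj₁ refl)
⇒⇒join drop-edge             = dropʳ (inj₂ refl)
⇒⇒join drop-topˡ             = centersˡ refl refl
⇒⇒join drop-topʳ             = centersʳ refl refl

dropˡ⇒ : ∀ {t s} → t ≡ • ⊎ t ≡ • ◂ • → t ◂ s ⇒ just s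
dropˡ⇒ (inj₁ refl) = keep-root leaf
dropˡ⇒ (inj₂ refl) = keep-root pair

dropʳ⇒ : ∀ {t s} → s ≡ • ⊎ s ≡ • ◂ • → t ◂ s ⇒ just t
dropʳ⇒ (inj₁ refl) = drop-root
dropʳ⇒ (inj₂ refl) = drop-edge

starT≡• : ∀ ns → starT ns ≡ • → counts ns ≡ (0 , 0)
starT≡• []          e = refl
starT≡• (zero ∷ ns) e = starT≡• ns e

starT≡◂• : ∀ ns {p} → starT ns ≡ p ◂ • → ∃ λ l → p ≡ path l × counts ns ≡ add (res (suc l)) (0 , 0) × sum ns ≡ suc l + 0
starT≡◂• (zero ∷ ns)  e = starT≡◂• ns e
starT≡◂• (suc l ∷ ns) e = l , ◂-injˡ e , cong (add (res (suc l))) (starT≡• ns (◂-injʳ e)) , cong (suc l +_) (sum≡0 ns (◂-injʳ e))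
  where
  ◂-injˡ : ∀ {t s t′ s′} → t ◂ s ≡ t′ ◂ s′ → t′ ≡ t
  ◂-injˡ refl = refl
  ◂-injʳ : ∀ {t s t′ s′} → t ◂ s ≡ t′ ◂ s′ → s ≡ s′
  ◂-injʳ refl = refl
  sum≡0 : ∀ ns → starT ns ≡ • → sum ns ≡ 0
  sum≡0 []          e = refl
  sum≡0 (zero ∷ ns) e = sum≡0 ns e

starT≡edge : ∀ ns → starT ns ≡ • ◂ • → counts ns ≡ (1 , 0)
starT≡edge ns e with zero , _ , c , _ ← starT≡◂• ns e = c

small : ∀ ns → starT ns ≡ • ⊎ starT ns ≡ • ◂ • → class ns ≡ c1* ⊎ class ns ≡ c2*
small ns (inj₁ e) = inj₁ (cong (uncurry cls) (starT≡• ns e))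
small ns (inj₂ e) = inj₂ (cong (uncurry cls) (starT≡edge ns e))

val≢bival-small : ∀ {c} d → c ≡ c1* ⊎ c ≡ c2* → val d ≢ bival c d
val≢bival-small d (inj₁ refl) = val≢bival-c1* d
val≢bival-small d (inj₂ refl) = val≢bival-c2* d

-- Deleting both centers shortens a path by two vertices.
path-centers : ∀ r → val (uncurry cls (add r (0 , 0))) ≢ bival (uncurry cls (add (next r) (0 , 0))) c1*
path-centers r0 ()
path-centers r1 ()
path-centers r2 ()

reaches-class : ∀ {ns x} → Reaches ns x → ∃ λ ns′ → ns ⊳ ns′ × class ns′ ≡ uncurry cls x
reaches-class (ns′ , m , e) = ns′ , m , cong (uncurry cls) e

-- The entry in `drop-star` sees only counts, yet whole deletion is legal only for one or two
-- vertices. Any larger star with these counts reaches class `c0` by shortening a path.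
drop-star⇒⊳ : ∀ ns a b → counts ns ≡ (a , b) → ∀ {c} → c ∈ drop-star a b →
              (∃ λ ns′ → ns ⊳ ns′ × class ns′ ≡ c) ⊎ (c ≡ c0 × (starT ns ≡ • ⊎ starT ns ≡ • ◂ •))
drop-star⇒⊳ ns 0 0 e (here refl) with reach-r0 ns e
... | inj₁ s≡•     = inj₂ (refl , inj₁ s≡•)
... | inj₂ (_ , r) = inj₁ (reaches-class r)
drop-star⇒⊳ ns 1 0 e (here refl) with reach-1,0 ns e
... | inj₁ s≡       = inj₂ (refl , inj₂ s≡)
... | inj₂ (inj₁ r) = inj₁ (reaches-class r)
... | inj₂ (inj₂ r) = inj₁ (reaches-class r)

moves⇒⊳ : ∀ ns a b → counts ns ≡ (a , b) → ∀ {c} → c ∈ moves a b →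
          (∃ λ ns′ → ns ⊳ ns′ × class ns′ ≡ c) ⊎ (c ≡ c0 × (starT ns ≡ • ⊎ starT ns ≡ • ◂ •))
moves⇒⊳ ns a b e c∈ with ∈-++⁻ (shorten₁ a b) c∈
moves⇒⊳ ns (suc a) b e c∈ | inj₁ (here refl) = inj₁ (reaches-class (reach-r1 ns e))
... | inj₂ c∈′ with ∈-++⁻ (shorten₂ a b) c∈′
moves⇒⊳ ns a (suc b) e c∈ | inj₂ c∈′ | inj₁ (here refl) = inj₁ (reaches-class (proj₁ (reach-r2 ns e)))
moves⇒⊳ ns a (suc b) e c∈ | inj₂ c∈′ | inj₁ (there (here refl)) = inj₁ (reaches-class (proj₂ (reach-r2 ns e)))
... | inj₂ c∈″ = drop-star⇒⊳ ns a b e c∈″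

-- A path of `suc l` vertices attached to `ms` can also be read as a second star centered at its
-- near end, and both readings must give one value. By the residue of `l`, that second star has
-- class `c1*`, `c2*` or `c0`.
grow-class : ∀ l ms → bival (class (l ∷ [])) (class ms) ≡ val (class (suc l ∷ ms))
grow-class l ms = add-next (res l) (proj₁ (counts ms)) (proj₂ (counts ms))
  where
  Grow : ℕ → ℕ → Set
  Grow a b = val (cls (suc a) b) ≡ bival c1* (cls a b) × val (cls a (suc b)) ≡ bival c2* (cls a b)
  grow : ∀ a b → Grow a b
  grow = periodic Grow (λ _ _ p → p) (λ _ _ p → p)
    (toWitness {a? = Fin.all? λ i → Fin.all? λ j → (_ ℕ.≟ _) ×-dec (_ ℕ.≟ _)} _)
  add-next : ∀ r a b → bival (uncurry cls (add r (0 , 0))) (cls a b) ≡ val (uncurry cls (add (next r) (a , b)))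
  add-next r0 a b = sym (proj₁ (grow a b))
  add-next r1 a b = sym (proj₂ (grow a b))
  add-next r2 a b = bival-c0 (cls a b)

val-• : Val (just •) 1
val-• = val-mex (λ { vertex → 0 , val-nothing , λ () }) (λ { zero _ → nothing , vertex , val-nothing ; (suc _) (s≤s ()) })

-- Simultaneous induction for stars and bistars

val-subst : ∀ {o m m′} → m ≡ m′ → Val o m → Val o m′
val-subst refl v = v

mutual
  -- Reading a star as a bistar turns the first vertex of a path into a center and lowers the sum by
  -- one, so the weak bound here becomes the strict bound of `bistar-val` for the same `N`. `N`
  -- itself drops whenever `bistar-val` calls back.
  star-val : ∀ N ms → sum ms ≤ N → Val (just (starT ms)) (val (class ms))
  star-val N []           _  = val-•
  star-val N (zero ∷ ms)  le = star-val N ms le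
  star-val N (suc l ∷ ms) le = val-subst (grow-class l ms)
    (subst (λ t → Val (just (t ◂ starT ms)) (bival (class (l ∷ [])) (class ms))) (sym (path≡starT l))
      (bistar-val N (l ∷ []) ms (subst (λ n → n + sum ms < N) (sym (ℕ.+-identityʳ l)) le)))

  bistar-val : ∀ N ns ms → sum ns + sum ms < N → Val (just (starT ns ◂ starT ms)) (bival (class ns) (class ms))
  bistar-val (suc N) ns ms (s≤s le) = val-mex other below
    where
    c d : Cls
    c = class ns
    d = class ms
    valˡ : ∀ {ns′} → ns ⊳ ns′ → Val (just (starT ns′ ◂ starT ms)) (bival (class ns′) d)
    valˡ {ns′} m = bistar-val N ns′ ms (ℕ.<-≤-trans (ℕ.+-monoˡ-< (sum ms) (⊳-sum m)) le)
    valʳ : ∀ {ms′} → ms ⊳ ms′ → Val (just (starT ns ◂ starT ms′)) (bival c (class ms′))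
    valʳ {ms′} m = bistar-val N ns ms′ (ℕ.<-≤-trans (ℕ.+-monoʳ-< (sum ns) (⊳-sum m)) le)
    val-ns : Val (just (starT ns)) (val c)
    val-ns = star-val N ns (ℕ.≤-trans (ℕ.m≤m+n (sum ns) (sum ms)) le)
    val-ms : Val (just (starT ms)) (val d)
    val-ms = star-val N ms (ℕ.≤-trans (ℕ.m≤n+m (sum ms) (sum ns)) le)
    -- What remains after deleting both centers is a path, hence again a star with one branch when
    -- centered at its end.
    val-path : ∀ {p} ks → starT ks ≡ p ◂ • → sum ks ≤ N → ∃ λ k → Val (just p) k × k ≢ bival (class ks) c1*
    val-path ks e le with l , refl , cnt , sm ← starT≡◂• ks e =
      val (class (l ∷ [])) ,
      subst (λ t → Val (just t) (val (class (l ∷ [])))) (sym (path≡starT l))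
        (star-val N (l ∷ []) (ℕ.≤-trans (ℕ.n≤1+n (l + 0)) (subst (_≤ N) sm le))) ,
      subst (λ x → val (class (l ∷ [])) ≢ bival (uncurry cls x) c1*) (sym cnt) (path-centers (res l))

    other : ∀ {o} → starT ns ◂ starT ms ⇒ o → ∃ λ k → Val o k × k ≢ bival c d
    other move with ⇒⇒join move
    ... | inˡ m with _ , m′ , refl ← ↝⇒⊳ ns m = _ , valˡ m′ , ⊳-distinct m′ d
    ... | inʳ m with ms′ , m′ , refl ← ↝⇒⊳ ms m =
      _ , valʳ m′ , λ e → ⊳-distinct m′ c (trans (bival-comm (class ms′) c) (trans e (bival-comm c d)))
    ... | dropˡ e = _ , val-ms , val≢bival-small d (small ns e)
    ... | dropʳ e = _ , val-ns , λ k≡ → val≢bival-small c (small ms e) (trans k≡ (bival-comm c d))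
    -- Two bare centers have `bival` equal to 2, so the option of value 0 does no harm.
    ... | drop-both e e′ = 0 , val-nothing ,
      subst₂ (λ x y → 0 ≢ bival (uncurry cls x) (uncurry cls y)) (sym (starT≡• ns e)) (sym (starT≡• ms e′)) λ ()
    ... | centersˡ e e′ =
      let k , v , k≢ = val-path ns e (ℕ.≤-trans (ℕ.m≤m+n (sum ns) (sum ms)) le)
      in k , v , subst (λ x → k ≢ bival c (uncurry cls x)) (sym (starT≡• ms e′)) k≢
    ... | centersʳ e e′ =
      let k , v , k≢ = val-path ms e′ (ℕ.≤-trans (ℕ.m≤n+m (sum ms) (sum ns)) le)
      in k , v , subst (λ x → k ≢ bival (uncurry cls x) d) (sym (starT≡• ns e)) λ k≡ → k≢ (trans k≡ (bival-comm c1* d))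

    Option : ℕ → Set
    Option k = ∃ λ o → starT ns ◂ starT ms ⇒ o × Val o k

    optionˡ : ∀ {ns′} → ns ⊳ ns′ → Option (bival (class ns′) d)
    optionˡ m = _ , keep-root (left (⊳⇒↝ m)) , valˡ m
    optionʳ : ∀ {ms′} → ms ⊳ ms′ → Option (bival c (class ms′))
    optionʳ m = _ , keep-root (right (⊳⇒↝ m)) , valʳ m

    -- A star that is not a bare center moves to counts (1 , 0), of class `c2*`, and `c2*` against
    -- `c1*` has value 0. If both are bare centers, the whole edge is deleted.
    option-zero : counts ns ≡ (0 , 0) → counts ms ≡ (0 , 0) → Option 0
    option-zero en em with reach-r0 ns en | reach-r0 ms em
    ... | inj₂ ((ns′ , m , e) , _) | _ =
      subst Option (cong₂ (λ x y → bival (uncurry cls x) (uncurry cls y)) e em) (optionˡ m)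
    ... | inj₁ _ | inj₂ ((ms′ , m , e) , _) =
      subst Option (cong₂ (λ x y → bival (uncurry cls x) (uncurry cls y)) en e) (optionʳ m)
    ... | inj₁ e | inj₁ e′ = nothing , subst₂ (λ t s → t ◂ s ⇒ nothing) (sym e) (sym e′) edge , val-nothing

    option-movesˡ : ∀ {c′} → c′ ∈ uncurry moves (counts ns) → Option (bival c′ d)
    option-movesˡ c′∈ with moves⇒⊳ ns _ _ refl c′∈
    ... | inj₁ (ns′ , m , refl) = optionˡ m
    ... | inj₂ (refl , e)       = just (starT ms) , dropˡ⇒ e , val-subst (sym (bival-c0 d)) val-ms
    option-movesʳ : ∀ {d′} → d′ ∈ uncurry moves (counts ms) → Option (bival c d′)
    option-movesʳ d′∈ with moves⇒⊳ ms _ _ refl d′∈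
    ... | inj₁ (ms′ , m , refl) = optionʳ m
    ... | inj₂ (refl , e)       =
      just (starT ns) , dropʳ⇒ e , val-subst (sym (trans (bival-comm c c0) (bival-c0 c))) val-ns

    attained⇒option : ∀ {k} → k ∈ map (λ c′ → bival c′ d) (uncurry moves (counts ns))
                            ⊎ k ∈ map (bival c) (uncurry moves (counts ms))
                            ⊎ (((proj₁ (counts ns) ≡ 0 × proj₂ (counts ns) ≡ 0)
                              × (proj₁ (counts ms) ≡ 0 × proj₂ (counts ms) ≡ 0)) × k ≡ 0) → Option k
    attained⇒option (inj₁ k∈) with c′ , c′∈ , refl ← ∈-map⁻ (λ c′ → bival c′ d) k∈ = option-movesˡ c′∈
    attained⇒option (inj₂ (inj₁ k∈)) with d′ , d′∈ , refl ← ∈-map⁻ (bival c) k∈ = option-movesʳ d′∈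
    attained⇒option (inj₂ (inj₂ (((a≡0 , b≡0) , (a′≡0 , b′≡0)) , refl))) =
      option-zero (cong₂ _,_ a≡0 b≡0) (cong₂ _,_ a′≡0 b′≡0)

    below : ∀ k → k < bival c d → Option k
    below k k< = subst Option (Fin.toℕ-fromℕ< k<) (attained⇒option
      (attains (proj₁ (counts ns)) (proj₂ (counts ns)) (proj₁ (counts ms)) (proj₂ (counts ms)) (fromℕ< k<)))

-- Edge lists

Link : ∀ {n} → Fin n → Fin n → Fin n × Fin n → Set
Link u v e = (u ≡ proj₁ e × v ≡ proj₂ e) ⊎ (u ≡ proj₂ e × v ≡ proj₁ e)

Linked : ∀ {n} → Edges n → Fin n → Fin n → Set
Linked E u v = Any (Link u v) E

≟⁻ : ∀ {n} (u v : Fin n) → ⌊ u Fin.≟ v ⌋ ≡ true → u ≡ v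
≟⁻ u v e = toWitness {a? = u Fin.≟ v} (true⇒T e)

≟-refl : ∀ {n} (u : Fin n) → ⌊ u Fin.≟ u ⌋ ≡ true
≟-refl u = T⇒true (fromWitness {a? = u Fin.≟ u} refl)

linkᵇ : ∀ {n} → Fin n → Fin n → Fin n × Fin n → Bool
linkᵇ u v e = (⌊ u Fin.≟ proj₁ e ⌋ ∧ ⌊ v Fin.≟ proj₂ e ⌋) ∨ (⌊ u Fin.≟ proj₂ e ⌋ ∧ ⌊ v Fin.≟ proj₁ e ⌋)

link⁻ : ∀ {n} (u v : Fin n) {e} → T (linkᵇ u v e) → Link u v e
link⁻ u v {x , y} t with ∨⁻ (⌊ u Fin.≟ x ⌋ ∧ ⌊ v Fin.≟ y ⌋) (T⇒true t)
... | inj₁ p = inj₁ (Product.map (≟⁻ u x) (≟⁻ v y) (∧⁻ ⌊ u Fin.≟ x ⌋ p))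
... | inj₂ p = inj₂ (Product.map (≟⁻ u y) (≟⁻ v x) (∧⁻ ⌊ u Fin.≟ y ⌋ p))

link⁺ : ∀ {n} (u v : Fin n) {e} → Link u v e → T (linkᵇ u v e)
link⁺ u v {x , y} (inj₁ (refl , refl)) rewrite ≟-refl u | ≟-refl v = tt
link⁺ u v {x , y} (inj₂ (refl , refl)) rewrite ≟-refl u | ≟-refl v = true⇒T (∨-zeroʳ (⌊ u Fin.≟ v ⌋ ∧ ⌊ v Fin.≟ u ⌋))

toAdj⁻ : ∀ {n} (E : Edges n) u v → toAdj E u v ≡ true → u ≢ v × Linked E u v
toAdj⁻ E u v e with u Fin.≟ v
... | no u≢v = u≢v , Any.map (link⁻ u v) (Any.any⁻ (linkᵇ u v) E (true⇒T e))

toAdj⁺ : ∀ {n} (E : Edges n) u v → u ≢ v → Linked E u v → toAdj E u v ≡ true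
toAdj⁺ E u v u≢v l with u Fin.≟ v
... | yes u≡v = contradiction u≡v u≢v
... | no _    = T⇒true (Any.any⁺ (linkᵇ u v) (Any.map (link⁺ u v) l))

linked-sym : ∀ {n} {E : Edges n} {u v} → Linked E u v → Linked E v u
linked-sym = Any.map [ (λ (e , e′) → inj₂ (e′ , e)) , (λ (e , e′) → inj₁ (e′ , e)) ]

mapE : ∀ {n k} → (Fin n → Fin k) → Edges n → Edges k
mapE h = map (λ e → h (proj₁ e) , h (proj₂ e))

module _ {n k} (h : Fin n → Fin k) where

  linked-map⁺ : ∀ {E u v} → Linked E u v → Linked (mapE h E) (h u) (h v)
  linked-map⁺ = Any.map⁺ ∘ Any.map (Sum.map (Product.map (cong h) (cong h)) (Product.map (cong h) (cong h)))

  linked-map⁻ : (∀ {i j} → h i ≡ h j → i ≡ j) → ∀ {E u v} → Linked (mapE h E) (h u) (h v) → Linked E u v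
  linked-map⁻ inj = Any.map (Sum.map (Product.map inj inj) (Product.map inj inj)) ∘ Any.map⁻

  ¬linked-map : ∀ {E u v} → (∀ i → u ≢ h i) → ¬ Linked (mapE h E) u v
  ¬linked-map out l with Any.satisfied (Any.map⁻ l)
  ... | _ , inj₁ (e , _) = out _ e
  ... | _ , inj₂ (e , _) = out _ e

bool-ext : ∀ {a b} → (a ≡ true → b ≡ true) → (b ≡ true → a ≡ true) → a ≡ b
bool-ext {true}          f g = sym (f refl)
bool-ext {false} {true}  f g = g refl
bool-ext {false} {false} f g = refl

_≟ⱽ_ : ∀ {t} (u v : V t) → Dec (u ≡ v)
_≟ⱽ_ {•}     tt tt = yes refl
_≟ⱽ_ {t ◂ s} u  v  = Sum.≡-dec _≟ⱽ_ _≟ⱽ_ u v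

-- Edges are described by `Linked` rather than `toAdj`, so that extending the edge list becomes a
-- case distinction. `at-zero` fixes the center, where paths and the bistar edge are attached.
record Rooted {m} (E : Edges (suc m)) (t : Tree) : Set where
  field
    at            : Fin (suc m) → V t
    at-injective  : ∀ {i j} → at i ≡ at j → i ≡ j
    at-surjective : ∀ v → ∃ λ i → at i ≡ v
    at-zero       : at zero ≡ root t
    linked⇒adj    : ∀ i j → i ≢ j → Linked E i j → adj t (at i) (at j) ≡ true
    adj⇒linked    : ∀ i j → adj t (at i) (at j) ≡ true → Linked E i j
open Rooted

adj⇒≢ : ∀ {A : Set} {t} {f : A → V t} {i j} → adj t (f i) (f j) ≡ true → i ≢ j
adj⇒≢ {t = t} {f} {i} e refl with () ← trans (sym e) (adj-irrefl t (f i))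

real-of : ∀ {n} {E : Edges n} {t} (f : Fin n → V t) → (∀ {i j} → f i ≡ f j → i ≡ j) → (∀ v → ∃ λ i → f i ≡ v) →
          (∀ i j → i ≢ j → Linked E i j → adj t (f i) (f j) ≡ true) → (∀ i j → adj t (f i) (f j) ≡ true → Linked E i j) →
          Real (toAdj E) (just t)
real-of {E = E} {t} f inj surj linked⇒ ⇒linked = record
  { to      = f
  ; from    = λ v → proj₁ (surj v)
  ; from-to = λ i → inj (proj₂ (surj (f i)))
  ; to-from = λ v → proj₂ (surj v)
  ; to-adj  = λ i j → bool-ext (λ e → let i≢j , l = toAdj⁻ E i j e in linked⇒ i j i≢j l)
                               (λ e → toAdj⁺ E i j (adj⇒≢ {t = t} {f} e) (⇒linked i j e))
  }

rooted-real : ∀ {m} {E : Edges (suc m)} {t} → Rooted E t → Real (toAdj E) (just t)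
rooted-real R = real-of (at R) (at-injective R) (at-surjective R) (linked⇒adj R) (adj⇒linked R)

-- `t′` is `t` with a new leaf `q` hung on `p`. Phrasing this as a deletion reuses its embedding for
-- the old vertices.
record LeafExt (t : Tree) (p : V t) (t′ : Tree) (q : V t′) : Set where
  field
    deletion  : RootDel t′ (q ∷ []) t
    q-nonroot : isRoot t′ q ≡ false
    q-adj⇒    : ∀ w → adj t′ q (emb (proj₁ deletion) w) ≡ true → w ≡ p
    q-adj-p   : adj t′ q (emb (proj₁ deletion) p) ≡ true
open LeafExt

leafExt-root : ∀ s → LeafExt s (root s) (• ◂ s) (inj₁ tt)
leafExt-root s = record
  { deletion = leaf-del ; q-nonroot = refl ; q-adj⇒ = isRoot⇒≡root s ; q-adj-p = isRoot-root s }

leafExt-left : ∀ {t p t′ q} s → LeafExt t p t′ q → LeafExt (t ◂ s) (inj₁ p) (t′ ◂ s) (inj₁ q)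
leafExt-left s x = record
  { deletion  = del-left (deletion x)
  ; q-nonroot = refl
  ; q-adj⇒    = λ { (inj₁ w) e → cong inj₁ (q-adj⇒ x w e)
                  ; (inj₂ w) e → contradiction (trans (sym (q-nonroot x)) (proj₁ (∧⁻ _ e))) λ () }
  ; q-adj-p   = q-adj-p x
  }

path-end : ∀ l → V (path l)
path-end zero    = tt
path-end (suc l) = inj₁ (path-end l)

-- `pathFrom` lengthens a path at its far end, whereas `path` grows at its root; this reconciles the
-- two.
leafExt-path : ∀ l → LeafExt (path l) (path-end l) (path (suc l)) (path-end (suc l))
leafExt-path zero    = leafExt-root •
leafExt-path (suc l) = leafExt-left • (leafExt-path l)

module _ {m} {E : Edges (suc m)} {t t′ q} {p} (R : Rooted E t) (x : LeafExt t (at R p) t′ q) where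

  private
    d : Del t′ (q ∷ []) (just t)
    d = proj₁ (deletion x)

    f : Fin (suc (suc m)) → V t′
    f i with view i
    ... | ‵fromℕ     = q
    ... | ‵inject₁ j = emb d (at R j)

    f-new : f (fromℕ (suc m)) ≡ q
    f-new rewrite view-fromℕ (suc m) = refl

    f-old : ∀ i → f (inject₁ i) ≡ emb d (at R i)
    f-old i rewrite view-inject₁ i = refl

    emb≢q : ∀ {w} → emb d w ≢ q
    emb≢q {w} e = emb-avoids d w (here e)

    f-injective : ∀ {i j} → f i ≡ f j → i ≡ j
    f-injective {i} {j} e with view i | view j
    ... | ‵fromℕ     | ‵fromℕ     = refl
    ... | ‵fromℕ     | ‵inject₁ _ = contradiction (sym e) emb≢q
    ... | ‵inject₁ _ | ‵fromℕ     = contradiction e emb≢q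
    ... | ‵inject₁ _ | ‵inject₁ _ = cong inject₁ (at-injective R (emb-injective d e))

    f-surjective : ∀ v → ∃ λ i → f i ≡ v
    f-surjective v with v ≟ⱽ q
    ... | yes refl = fromℕ (suc m) , f-new
    ... | no v≢q with w , refl ← emb-covers d v (∉₁ v≢q) with i , refl ← at-surjective R w = inject₁ i , f-old i

    f-zero : f zero ≡ root t′
    f-zero = trans (f-old zero) (trans (cong (emb d) (at-zero R))
      (isRoot⇒≡root t′ _ (trans (proj₂ (deletion x) (root t)) (isRoot-root t))))

    old≢new : ∀ (i : Fin (suc m)) → fromℕ (suc m) ≢ inject₁ i
    old≢new i = Fin.fromℕ≢inject₁

    new⇒p : ∀ {j} → Linked (addLeaf E p) (fromℕ (suc m)) (inject₁ j) → j ≡ p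
    new⇒p (here (inj₁ (_ , e))) = Fin.inject₁-injective e
    new⇒p (here (inj₂ (e , _))) = contradiction e (old≢new _)
    new⇒p (there l)             = contradiction l (¬linked-map inject₁ old≢new)

    p-linked : ∀ j → adj t′ q (emb d (at R j)) ≡ true → Linked (addLeaf E p) (fromℕ (suc m)) (inject₁ j)
    p-linked j e = here (inj₁ (refl , cong inject₁ (at-injective R (q-adj⇒ x _ e))))

    old⁻ : ∀ {i j} → Linked (addLeaf E p) (inject₁ i) (inject₁ j) → Linked E i j
    old⁻ (here (inj₁ (e , _))) = contradiction (sym e) (old≢new _)
    old⁻ (here (inj₂ (_ , e))) = contradiction (sym e) (old≢new _)
    old⁻ (there l)             = linked-map⁻ inject₁ Fin.inject₁-injective l

    linked⇒ : ∀ i j → i ≢ j → Linked (addLeaf E p) i j → adj t′ (f i) (f j) ≡ true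
    linked⇒ i j i≢j l with view i | view j
    ... | ‵fromℕ     | ‵fromℕ     = contradiction refl i≢j
    ... | ‵fromℕ     | ‵inject₁ j = subst (λ k → adj t′ q (emb d (at R k)) ≡ true) (sym (new⇒p l)) (q-adj-p x)
    ... | ‵inject₁ i | ‵fromℕ     = trans (adj-sym t′ _ q)
            (subst (λ k → adj t′ q (emb d (at R k)) ≡ true) (sym (new⇒p (linked-sym l))) (q-adj-p x))
    ... | ‵inject₁ i | ‵inject₁ j =
            trans (sym (emb-adj d _ _)) (linked⇒adj R i j (i≢j ∘ cong inject₁) (old⁻ l))

    ⇒linked : ∀ i j → adj t′ (f i) (f j) ≡ true → Linked (addLeaf E p) i j
    ⇒linked i j e with view i | view j
    ... | ‵fromℕ     | ‵fromℕ     = contradiction (trans (sym e) (adj-irrefl t′ q)) λ ()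
    ... | ‵fromℕ     | ‵inject₁ j = p-linked j e
    ... | ‵inject₁ i | ‵fromℕ     = linked-sym (p-linked i (trans (adj-sym t′ q _) e))
    ... | ‵inject₁ i | ‵inject₁ j = there (linked-map⁺ inject₁ (adj⇒linked R i j (trans (emb-adj d _ _) e)))

  addLeaf-rooted : Σ (Rooted (addLeaf E p) t′) λ R′ → at R′ (fromℕ (suc m)) ≡ q
  addLeaf-rooted = record
    { at = f ; at-injective = f-injective ; at-surjective = f-surjective ; at-zero = f-zero
    ; linked⇒adj = linked⇒ ; adj⇒linked = ⇒linked } , f-new

pathFrom-rooted : ∀ k l s {m} {E : Edges (suc m)} {p} (R : Rooted E (path l ◂ s)) → at R p ≡ inj₁ (path-end l) →
                  Rooted (proj₂ (pathFrom E p k)) (path (k + l) ◂ s)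
pathFrom-rooted zero    l s R _ = R
pathFrom-rooted (suc k) l s {E = E} {p} R e =
  let R′ , e′ = addLeaf-rooted R (subst (λ v → LeafExt (path l ◂ s) v (path (suc l) ◂ s) (inj₁ (path-end (suc l)))) (sym e) (leafExt-left s (leafExt-path l)))
  in subst (λ j → Rooted (proj₂ (pathFrom E p (suc k))) (path j ◂ s)) (ℕ.+-suc k l) (pathFrom-rooted k (suc l) s R′ e′)

starG-rooted : ∀ ls → Rooted (proj₂ (starG ls)) (starT (map suc ls))
starG-rooted [] = record
  { at = λ _ → tt ; at-injective = λ { {zero} {zero} _ → refl } ; at-surjective = λ _ → zero , refl ; at-zero = refl
  ; linked⇒adj = λ _ _ _ () ; adj⇒linked = λ _ _ () }
starG-rooted (l ∷ ls) =
  let s = starT (map suc ls)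
      R = starG-rooted ls
      -- The first vertex of the new path is hung on the center; the other `l` follow at its far
      -- end.
      R′ , e = addLeaf-rooted R (subst (λ v → LeafExt s v (• ◂ s) (inj₁ tt)) (sym (at-zero R)) (leafExt-root s))
  in subst (λ j → Rooted (proj₂ (starG (l ∷ ls))) (path j ◂ s)) (ℕ.+-identityʳ l) (pathFrom-rooted l 0 s R′ e)

-- Joining two rooted graphs at their centers

module _ {m m′} {E : Edges (suc m)} {E′ : Edges (suc m′)} {t s} (R : Rooted E t) (R′ : Rooted E′ s) where

  private
    B : Edges (suc m + suc m′)
    B = proj₂ (bistarG (m , E) (m′ , E′))

    L : Fin (suc m) → Fin (suc m + suc m′)
    L = _↑ˡ suc m′

    J : Fin (suc m′) → Fin (suc m + suc m′)
    J = suc m ↑ʳ_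

    data Side : Fin (suc m + suc m′) → Set where
      inL : ∀ i → Side (L i)
      inJ : ∀ i → Side (J i)

    side? : ∀ i → Side i
    side? i with splitAt (suc m) i in eq
    ... | inj₁ j = subst Side (Fin.splitAt⁻¹-↑ˡ eq) (inL j)
    ... | inj₂ j = subst Side (Fin.splitAt⁻¹-↑ʳ eq) (inJ j)

    L≢J : ∀ {i j} → L i ≢ J j
    L≢J {i} {j} e with () ← trans (sym (Fin.splitAt-↑ˡ (suc m) i (suc m′)))
                              (trans (cong (splitAt (suc m)) e) (Fin.splitAt-↑ʳ (suc m) (suc m′) j))

    L-injective : ∀ {i j} → L i ≡ L j → i ≡ j
    L-injective = Fin.↑ˡ-injective (suc m′) _ _

    J-injective : ∀ {i j} → J i ≡ J j → i ≡ j
    J-injective = Fin.↑ʳ-injective (suc m) _ _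

    f : Fin (suc m + suc m′) → V (t ◂ s)
    f i = Sum.map (at R) (at R′) (splitAt (suc m) i)

    f-L : ∀ i → f (L i) ≡ inj₁ (at R i)
    f-L i = cong (Sum.map (at R) (at R′)) (Fin.splitAt-↑ˡ (suc m) i (suc m′))

    f-J : ∀ i → f (J i) ≡ inj₂ (at R′ i)
    f-J i = cong (Sum.map (at R) (at R′)) (Fin.splitAt-↑ʳ (suc m) (suc m′) i)

    f-injective : ∀ {i j} → f i ≡ f j → i ≡ j
    f-injective {i} {j} e with side? i | side? j
    ... | inL i | inL j = cong L (at-injective R (inj₁-injective (trans (sym (f-L i)) (trans e (f-L j)))))
    ... | inJ i | inJ j = cong J (at-injective R′ (inj₂-injective (trans (sym (f-J i)) (trans e (f-J j)))))
    ... | inL i | inJ j with () ← trans (sym (f-L i)) (trans e (f-J j))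
    ... | inJ i | inL j with () ← trans (sym (f-J i)) (trans e (f-L j))

    f-surjective : ∀ v → ∃ λ i → f i ≡ v
    f-surjective (inj₁ v) with i , refl ← at-surjective R v  = L i , f-L i
    f-surjective (inj₂ v) with i , refl ← at-surjective R′ v = J i , f-J i

    isRoot-zero : ∀ {m} {E : Edges (suc m)} {t} (R : Rooted E t) → isRoot t (at R zero) ≡ true
    isRoot-zero {t = t} R = trans (cong (isRoot t) (at-zero R)) (isRoot-root t)

    root-zero : ∀ {m} {E : Edges (suc m)} {t} (R : Rooted E t) i → isRoot t (at R i) ≡ true → i ≡ zero
    root-zero {t = t} R i e = at-injective R (trans (isRoot⇒≡root t _ e) (sym (at-zero R)))

    LL⁻ : ∀ {i j} → Linked B (L i) (L j) → Linked E i j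
    LL⁻ (here (inj₁ (_ , e))) = contradiction e L≢J
    LL⁻ (here (inj₂ (e , _))) = contradiction e L≢J
    LL⁻ (there l) with Any.++⁻ (mapE L E) l
    ... | inj₁ l′ = linked-map⁻ L L-injective l′
    ... | inj₂ l′ = contradiction l′ (¬linked-map J λ _ → L≢J)

    JJ⁻ : ∀ {i j} → Linked B (J i) (J j) → Linked E′ i j
    JJ⁻ (here (inj₁ (e , _))) = contradiction (sym e) L≢J
    JJ⁻ (here (inj₂ (_ , e))) = contradiction (sym e) L≢J
    JJ⁻ (there l) with Any.++⁻ (mapE L E) l
    ... | inj₁ l′ = contradiction l′ (¬linked-map L λ _ → L≢J ∘ sym)
    ... | inj₂ l′ = linked-map⁻ J J-injective l′

    LJ⁻ : ∀ {i j} → Linked B (L i) (J j) → i ≡ zero × j ≡ zero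
    LJ⁻ (here (inj₁ (e , e′))) = L-injective e , J-injective e′
    LJ⁻ (here (inj₂ (e , _)))  = contradiction e L≢J
    LJ⁻ (there l) with Any.++⁻ (mapE L E) l
    ... | inj₁ l′ = contradiction (linked-sym l′) (¬linked-map L λ _ → L≢J ∘ sym)
    ... | inj₂ l′ = contradiction l′ (¬linked-map J λ _ → L≢J)

    cross⇒ : ∀ {i j} → Linked B (L i) (J j) → isRoot t (at R i) ∧ isRoot s (at R′ j) ≡ true
    cross⇒ l with refl , refl ← LJ⁻ l = cong₂ _∧_ (isRoot-zero R) (isRoot-zero R′)

    ⇒cross : ∀ i j → isRoot t (at R i) ∧ isRoot s (at R′ j) ≡ true → Linked B (L i) (J j)
    ⇒cross i j e = let ei , ej = ∧⁻ (isRoot t (at R i)) e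
                   in here (inj₁ (cong L (root-zero R i ei) , cong J (root-zero R′ j ej)))

    linked⇒ : ∀ i j → i ≢ j → Linked B i j → adj (t ◂ s) (f i) (f j) ≡ true
    linked⇒ i j i≢j l with side? i | side? j
    ... | inL i | inL j rewrite f-L i | f-L j = linked⇒adj R i j (i≢j ∘ cong L) (LL⁻ l)
    ... | inJ i | inJ j rewrite f-J i | f-J j = linked⇒adj R′ i j (i≢j ∘ cong J) (JJ⁻ l)
    ... | inL i | inJ j rewrite f-L i | f-J j = cross⇒ l
    ... | inJ i | inL j rewrite f-J i | f-L j = cross⇒ (linked-sym l)

    ⇒linked : ∀ i j → adj (t ◂ s) (f i) (f j) ≡ true → Linked B i j
    ⇒linked i j e with side? i | side? j
    ... | inL i | inL j rewrite f-L i | f-L j = there (Any.++⁺ˡ (linked-map⁺ L (adj⇒linked R i j e)))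
    ... | inJ i | inJ j rewrite f-J i | f-J j = there (Any.++⁺ʳ (mapE L E) (linked-map⁺ J (adj⇒linked R′ i j e)))
    ... | inL i | inJ j rewrite f-L i | f-J j = ⇒cross i j e
    ... | inJ i | inL j rewrite f-J i | f-L j = linked-sym (⇒cross j i e)

  bistarG-real : Real (toAdj B) (just (t ◂ s))
  bistarG-real = real-of f f-injective f-surjective linked⇒ ⇒linked

-- Grundy values of stars and bistars

-- Every subdivided star receives a class, since `∼₁` tests against all of them. The empty graph
-- gets `c0` because joining with it leaves the partner's value unchanged.
clsS : Star → Cls
clsS ∅         = c0
clsS (star ls) = class (map suc ls)

𝒢-star : ∀ S → 𝒢 (graphOf S) ≡ val (clsS S)
𝒢-star ∅         = refl
𝒢-star (star ls) = star-val _ (map suc ls) ℕ.≤-refl (rooted-real (starG-rooted ls))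

𝒢-bistar : ∀ S S′ → 𝒢 (bistar S S′) ≡ bival (clsS S) (clsS S′)
𝒢-bistar ∅         S′         = trans (𝒢-star S′) (sym (bival-c0 (clsS S′)))
𝒢-bistar (star ls) ∅          =
  trans (𝒢-star (star ls)) (sym (trans (bival-comm (clsS (star ls)) c0) (bival-c0 (clsS (star ls)))))
𝒢-bistar (star ls) (star ls′) =
  bistar-val _ (map suc ls) (map suc ls′) ℕ.≤-refl (bistarG-real (starG-rooted ls) (starG-rooted ls′))

clsR : ℛ → Cls
clsR emptyR      = c0
clsR (starR a b) = cls a b

counts-ℛ : ∀ a b → counts (map suc (replicate a 0 ++ replicate b 1)) ≡ (a , b)
counts-ℛ zero    zero    = refl
counts-ℛ zero    (suc b) = cong (add r2) (counts-ℛ zero b)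
counts-ℛ (suc a) b       = cong (add r1) (counts-ℛ a b)

clsS-toStar : ∀ S → clsS (toStar S) ≡ clsR S
clsS-toStar emptyR      = refl
clsS-toStar (starR a b) = cong (uncurry cls) (counts-ℛ a b)

𝒢ℛ≡val : ∀ S → 𝒢ℛ S ≡ val (clsR S)
𝒢ℛ≡val S = trans (𝒢-star (toStar S)) (cong val (clsS-toStar S))

𝒢-bistarℛ : ∀ S S′ → 𝒢 (bistarℛ S S′) ≡ bival (clsR S) (clsR S′)
𝒢-bistarℛ S S′ = trans (𝒢-bistar (toStar S) (toStar S′)) (cong₂ bival (clsS-toStar S) (clsS-toStar S′))

-- The empty graph, P₁ and S₁ tell the eight classes apart.
separate : ∀ {c c′} → bival c c0 ≡ bival c′ c0 → bival c c1* ≡ bival c′ c1* → bival c c2* ≡ bival c′ c2* → c ≡ c′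
separate {c} {c′} e₀ e₁ e₂ = trans (sym (decode-bival c)) (trans (decode-cong e₀ e₁ e₂) (decode-bival c′))
  where
  decode : ℕ → ℕ → ℕ → Cls
  decode 0 _ _ = c0
  decode 1 0 _ = c1
  decode 1 _ _ = c1*
  decode 2 0 _ = c2*
  decode 2 _ 0 = c2
  decode 2 _ _ = c2□
  decode _ _ 0 = c3□
  decode _ _ _ = c3
  decode-cong : ∀ {i i′ j j′ k k′} → i ≡ i′ → j ≡ j′ → k ≡ k′ → decode i j k ≡ decode i′ j′ k′
  decode-cong refl refl refl = refl
  decode-bival : ∀ c → decode (bival c c0) (bival c c1*) (bival c c2*) ≡ c
  decode-bival c0  = refl
  decode-bival c1  = refl
  decode-bival c1* = refl
  decode-bival c2  = refl
  decode-bival c2* = refl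
  decode-bival c2□ = refl
  decode-bival c3  = refl
  decode-bival c3□ = refl

_≟ᶜ_ : (c c′ : Cls) → Dec (c ≡ c′)
c ≟ᶜ c′ = map′ (λ (e₀ , e₁ , e₂) → separate e₀ e₁ e₂) (λ { refl → refl , refl , refl })
  ((bival c c0 ℕ.≟ bival c′ c0) ×-dec (bival c c1* ℕ.≟ bival c′ c1*) ×-dec (bival c c2* ℕ.≟ bival c′ c2*))

∼ℛ⇒clsR≡ : ∀ {S S′} → S ∼ℛ S′ → clsR S ≡ clsR S′
∼ℛ⇒clsR≡ {S} {S′} S∼S′ = subst₂ _≡_ (clsS-toStar S) (clsS-toStar S′) (separate (test ∅) (test (star [])) (test (star (0 ∷ []))))
  where
  test : ∀ Ŝ → bival (clsS (toStar S)) (clsS Ŝ) ≡ bival (clsS (toStar S′)) (clsS Ŝ)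
  test Ŝ = trans (sym (𝒢-bistar (toStar S) Ŝ)) (trans (S∼S′ Ŝ) (𝒢-bistar (toStar S′) Ŝ))

clsR≡⇒∼ℛ : ∀ {S S′} → clsR S ≡ clsR S′ → S ∼ℛ S′
clsR≡⇒∼ℛ {S} {S′} e Ŝ = trans (𝒢-bistar (toStar S) Ŝ)
  (trans (cong (λ c → bival c (clsS Ŝ)) (trans (clsS-toStar S) (trans e (sym (clsS-toStar S′))))) (sym (𝒢-bistar (toStar S′) Ŝ)))

-- Membership in the classes

-- The class does not occur once a is at least 3 or b at least 5, so the induction steps only pass
-- on a contradiction.
cls≡c1* : ∀ a b → cls a b ≡ c1* → (a ≡ 0 × b ≡ 0) ⊎ (a ≡ 1 × b ≡ 1) ⊎ (a ≡ 0 × b ≡ 3)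
cls≡c1* = periodic (λ a b → cls a b ≡ c1* → (a ≡ 0 × b ≡ 0) ⊎ (a ≡ 1 × b ≡ 1) ⊎ (a ≡ 0 × b ≡ 3))
  (λ a b p e → case₁ (p e)) (λ a b p e → case₂ (p e))
  (toWitness {a? = Fin.all? λ i → Fin.all? λ j → (_ ≟ᶜ _) →-dec
    (((_ ℕ.≟ _) ×-dec (_ ℕ.≟ _)) ⊎-dec (((_ ℕ.≟ _) ×-dec (_ ℕ.≟ _)) ⊎-dec ((_ ℕ.≟ _) ×-dec (_ ℕ.≟ _))))} _)
  where
  case₁ : ∀ {a b} {A : Set} → (3 + a ≡ 0 × b ≡ 0) ⊎ (3 + a ≡ 1 × b ≡ 1) ⊎ (3 + a ≡ 0 × b ≡ 3) → A
  case₁ (inj₁ (() , _))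
  case₁ (inj₂ (inj₁ (() , _)))
  case₁ (inj₂ (inj₂ (() , _)))
  case₂ : ∀ {a b} {A : Set} → (a ≡ 0 × 5 + b ≡ 0) ⊎ (a ≡ 1 × 5 + b ≡ 1) ⊎ (a ≡ 0 × 5 + b ≡ 3) → A
  case₂ (inj₁ (_ , ()))
  case₂ (inj₂ (inj₁ (_ , ())))
  case₂ (inj₂ (inj₂ (_ , ())))

cls≡c2* : ∀ a b → cls a b ≡ c2* → (a ≡ 1 × b ≡ 0) ⊎ (a ≡ 0 × b ≡ 2)
cls≡c2* = periodic (λ a b → cls a b ≡ c2* → (a ≡ 1 × b ≡ 0) ⊎ (a ≡ 0 × b ≡ 2))
  (λ a b p e → case₁ (p e)) (λ a b p e → case₂ (p e))
  (toWitness {a? = Fin.all? λ i → Fin.all? λ j → (_ ≟ᶜ _) →-dec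
    (((_ ℕ.≟ _) ×-dec (_ ℕ.≟ _)) ⊎-dec ((_ ℕ.≟ _) ×-dec (_ ℕ.≟ _)))} _)
  where
  case₁ : ∀ {a b} {A : Set} → (3 + a ≡ 1 × b ≡ 0) ⊎ (3 + a ≡ 0 × b ≡ 2) → A
  case₁ (inj₁ (() , _))
  case₁ (inj₂ (() , _))
  case₂ : ∀ {a b} {A : Set} → (a ≡ 1 × 5 + b ≡ 0) ⊎ (a ≡ 0 × 5 + b ≡ 2) → A
  case₂ (inj₁ (_ , ()))
  case₂ (inj₂ (_ , ()))

-- `C2□` and `C3□` are defined by a value and a number of paths; for these b the table has no other
-- class of value 2 or 3.
Box : ℕ → ℕ → Set
Box a b = (b ≡ 1 ⊎ b ≡ 3) → (val (cls a b) ≡ 2 → cls a b ≡ c2□) × (val (cls a b) ≡ 3 → cls a b ≡ c3□)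

box : ∀ a b → Box a b
box = periodic Box (λ _ _ p → p) (λ { _ _ _ (inj₁ ()) ; _ _ _ (inj₂ ()) })
  (toWitness {a? = Fin.all? λ i → Fin.all? λ j → ((_ ℕ.≟ _) ⊎-dec (_ ℕ.≟ _)) →-dec
    (((_ ℕ.≟ _) →-dec (_ ≟ᶜ _)) ×-dec ((_ ℕ.≟ _) →-dec (_ ≟ᶜ _)))} _)

cls≡box : ∀ a b → cls a b ≡ c2□ ⊎ cls a b ≡ c3□ → b ≡ 1 ⊎ b ≡ 3
cls≡box = periodic (λ a b → cls a b ≡ c2□ ⊎ cls a b ≡ c3□ → b ≡ 1 ⊎ b ≡ 3)
  (λ _ _ p → p) (λ a b p e → contradiction (p e) λ { (inj₁ ()) ; (inj₂ ()) })
  (toWitness {a? = Fin.all? λ i → Fin.all? λ j → ((_ ≟ᶜ _) ⊎-dec (_ ≟ᶜ _)) →-dec ((_ ℕ.≟ _) ⊎-dec (_ ℕ.≟ _))} _)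

C1*⇒ : ∀ {S} → C1* S → clsR S ≡ c1*
C1*⇒ (inj₁ refl)        = refl
C1*⇒ (inj₂ (inj₁ refl)) = refl
C1*⇒ (inj₂ (inj₂ refl)) = refl

C1*⇐ : ∀ S → clsR S ≡ c1* → C1* S
C1*⇐ (starR a b) e with cls≡c1* a b e
... | inj₁ (refl , refl)        = inj₁ refl
... | inj₂ (inj₁ (refl , refl)) = inj₂ (inj₁ refl)
... | inj₂ (inj₂ (refl , refl)) = inj₂ (inj₂ refl)

C2*⇒ : ∀ {S} → C2* S → clsR S ≡ c2*
C2*⇒ (inj₁ refl) = refl
C2*⇒ (inj₂ refl) = refl

C2*⇐ : ∀ S → clsR S ≡ c2* → C2* S
C2*⇐ (starR a b) e with cls≡c2* a b e
... | inj₁ (refl , refl) = inj₁ refl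
... | inj₂ (refl , refl) = inj₂ refl

C2□⇒ : ∀ {S} → C2□ S → clsR S ≡ c2□
C2□⇒ {S} (a , b , refl , v , b∈) = proj₁ (box a b b∈) (trans (sym (𝒢ℛ≡val S)) v)

C3□⇒ : ∀ {S} → C3□ S → clsR S ≡ c3□
C3□⇒ {S} (a , b , refl , v , b∈) = proj₂ (box a b b∈) (trans (sym (𝒢ℛ≡val S)) v)

C2□⇐ : ∀ S → clsR S ≡ c2□ → C2□ S
C2□⇐ S@(starR a b) e = a , b , refl , trans (𝒢ℛ≡val S) (cong val e) , cls≡box a b (inj₁ e)

C3□⇐ : ∀ S → clsR S ≡ c3□ → C3□ S
C3□⇐ S@(starR a b) e = a , b , refl , trans (𝒢ℛ≡val S) (cong val e) , cls≡box a b (inj₂ e)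

plain : ℕ → Cls
plain 0 = c0
plain 1 = c1
plain 2 = c2
plain _ = c3

plain-val : ∀ c → c ≢ c1* → c ≢ c2* → c ≢ c2□ → c ≢ c3□ → c ≡ plain (val c)
plain-val c0  _ _ _ _ = refl
plain-val c1  _ _ _ _ = refl
plain-val c2  _ _ _ _ = refl
plain-val c3  _ _ _ _ = refl
plain-val c1* n _ _ _ = contradiction refl n
plain-val c2* _ n _ _ = contradiction refl n
plain-val c2□ _ _ n _ = contradiction refl n
plain-val c3□ _ _ _ n = contradiction refl n

Cplain⇒ : ∀ {i S} → Cplain i S → clsR S ≡ plain i
Cplain⇒ {S = S} (v , n₁ , n₂ , n₃ , n₄) = trans
  (plain-val (clsR S) (n₁ ∘ C1*⇐ S) (n₂ ∘ C2*⇐ S) (n₃ ∘ C2□⇐ S) (n₄ ∘ C3□⇐ S))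
  (cong plain (trans (sym (𝒢ℛ≡val S)) v))

Cplain⇐ : ∀ {c} S → clsR S ≡ c → c ≢ c1* → c ≢ c2* → c ≢ c2□ → c ≢ c3□ → Cplain (val c) S
Cplain⇐ S refl n₁ n₂ n₃ n₄ = 𝒢ℛ≡val S , n₁ ∘ C1*⇒ , n₂ ∘ C2*⇒ , n₃ ∘ C2□⇒ , n₄ ∘ C3□⇒

∈C⇒ : ∀ {S} c → S ∈C c → clsR S ≡ c
∈C⇒ c0  = Cplain⇒
∈C⇒ c1  = Cplain⇒
∈C⇒ c1* = C1*⇒
∈C⇒ c2  = Cplain⇒
∈C⇒ c2* = C2*⇒
∈C⇒ c2□ = C2□⇒
∈C⇒ c3  = Cplain⇒
∈C⇒ c3□ = C3□⇒

∈C⇐ : ∀ {S} c → clsR S ≡ c → S ∈C c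
∈C⇐ {S} c0  e = Cplain⇐ S e (λ ()) (λ ()) (λ ()) (λ ())
∈C⇐ {S} c1  e = Cplain⇐ S e (λ ()) (λ ()) (λ ()) (λ ())
∈C⇐ {S} c1* e = C1*⇐ S e
∈C⇐ {S} c2  e = Cplain⇐ S e (λ ()) (λ ()) (λ ()) (λ ())
∈C⇐ {S} c2* e = C2*⇐ S e
∈C⇐ {S} c2□ e = C2□⇐ S e
∈C⇐ {S} c3  e = Cplain⇐ S e (λ ()) (λ ()) (λ ()) (λ ())
∈C⇐ {S} c3□ e = C3□⇐ S e

class-of : ∀ {S c} → clsR S ≡ c → ∀ S′ → (S ∼ℛ S′) ⇔ (S′ ∈C c)
class-of {S} {c} e S′ = mk⇔ (λ S∼S′ → ∈C⇐ c (trans (sym (∼ℛ⇒clsR≡ {S} {S′} S∼S′)) e))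
                            (λ S′∈c → clsR≡⇒∼ℛ {S} {S′} (trans e (sym (∈C⇒ c S′∈c))))

-- All eight sets are inhabited, so each of them really is an equivalence class.
representative : ∀ c → ∃ λ S → clsR S ≡ c
representative c0  = emptyR , refl
representative c1  = starR 3 0 , refl
representative c1* = starR 0 0 , refl
representative c2  = starR 0 5 , refl
representative c2* = starR 1 0 , refl
representative c2□ = starR 2 1 , refl
representative c3  = starR 1 5 , refl
representative c3□ = starR 3 1 , refl

Exc⇒bival : ∀ S S′ {v} → Exc S S′ v → bival (clsR S) (clsR S′) ≡ v
Exc⇒bival S S′ (inj₁ (p , q , refl)) = cong₂ bival (C1*⇒ p) (C1*⇒ q)
Exc⇒bival S S′ (inj₂ (inj₁ (p , q , refl))) = cong₂ bival (C1*⇒ p) (C2*⇒ q)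
Exc⇒bival S S′ (inj₂ (inj₂ (inj₁ (p , q , refl)))) = cong₂ bival (C2*⇒ p) (C1*⇒ q)
Exc⇒bival S S′ (inj₂ (inj₂ (inj₂ (inj₁ (p , q , refl))))) = cong₂ bival (C2*⇒ p) (C2*⇒ q)
Exc⇒bival S S′ (inj₂ (inj₂ (inj₂ (inj₂ (inj₁ (p , q , refl)))))) = cong₂ bival (C2*⇒ p) (C2□⇒ q)
Exc⇒bival S S′ (inj₂ (inj₂ (inj₂ (inj₂ (inj₂ (inj₁ (p , q , refl))))))) = cong₂ bival (C2□⇒ p) (C2*⇒ q)
Exc⇒bival S S′ (inj₂ (inj₂ (inj₂ (inj₂ (inj₂ (inj₂ (inj₁ (p , q , refl)))))))) = cong₂ bival (C2*⇒ p) (C3□⇒ q)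
Exc⇒bival S S′ (inj₂ (inj₂ (inj₂ (inj₂ (inj₂ (inj₂ (inj₂ (p , q , refl)))))))) = cong₂ bival (C3□⇒ p) (C2*⇒ q)

-- The exceptional pairs

Regular : Cls → Cls → Set
Regular c c′ = bival c c′ ≡ val c ⊕ val c′

Exceptional : Cls → Cls → Set
Exceptional c c′ = (c ≡ c1* × c′ ≡ c1*) ⊎ (c ≡ c1* × c′ ≡ c2*) ⊎ (c ≡ c2* × c′ ≡ c1*) ⊎ (c ≡ c2* × c′ ≡ c2*)
                 ⊎ (c ≡ c2* × c′ ≡ c2□) ⊎ (c ≡ c2□ × c′ ≡ c2*) ⊎ (c ≡ c2* × c′ ≡ c3□) ⊎ (c ≡ c3□ × c′ ≡ c2*)

regular⊎exceptional : ∀ c c′ → Regular c c′ ⊎ Exceptional c c′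
regular⊎exceptional = toWitness {a? = ∀Cls? λ c → ∀Cls? λ c′ → (_ ℕ.≟ _) ⊎-dec
  (both ⊎-dec (both ⊎-dec (both ⊎-dec (both ⊎-dec (both ⊎-dec (both ⊎-dec (both ⊎-dec both)))))))} _
  where
  both : ∀ {c d c′ d′} → Dec (c ≡ d × c′ ≡ d′)
  both = (_ ≟ᶜ _) ×-dec (_ ≟ᶜ _)

exceptional⇒Exc : ∀ S S′ → Exceptional (clsR S) (clsR S′) → ∃ λ v → Exc S S′ v
exceptional⇒Exc S S′ (inj₁ (p , q)) = _ , inj₁ (C1*⇐ S p , C1*⇐ S′ q , refl)
exceptional⇒Exc S S′ (inj₂ (inj₁ (p , q))) = _ , inj₂ (inj₁ (C1*⇐ S p , C2*⇐ S′ q , refl))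
exceptional⇒Exc S S′ (inj₂ (inj₂ (inj₁ (p , q)))) = _ , inj₂ (inj₂ (inj₁ (C2*⇐ S p , C1*⇐ S′ q , refl)))
exceptional⇒Exc S S′ (inj₂ (inj₂ (inj₂ (inj₁ (p , q))))) = _ , inj₂ (inj₂ (inj₂ (inj₁ (C2*⇐ S p , C2*⇐ S′ q , refl))))
exceptional⇒Exc S S′ (inj₂ (inj₂ (inj₂ (inj₂ (inj₁ (p , q)))))) =
  _ , inj₂ (inj₂ (inj₂ (inj₂ (inj₁ (C2*⇐ S p , C2□⇐ S′ q , refl)))))
exceptional⇒Exc S S′ (inj₂ (inj₂ (inj₂ (inj₂ (inj₂ (inj₁ (p , q))))))) =
  _ , inj₂ (inj₂ (inj₂ (inj₂ (inj₂ (inj₁ (C2□⇐ S p , C2*⇐ S′ q , refl))))))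
exceptional⇒Exc S S′ (inj₂ (inj₂ (inj₂ (inj₂ (inj₂ (inj₂ (inj₁ (p , q)))))))) =
  _ , inj₂ (inj₂ (inj₂ (inj₂ (inj₂ (inj₂ (inj₁ (C2*⇐ S p , C3□⇐ S′ q , refl)))))))
exceptional⇒Exc S S′ (inj₂ (inj₂ (inj₂ (inj₂ (inj₂ (inj₂ (inj₂ (p , q)))))))) =
  _ , inj₂ (inj₂ (inj₂ (inj₂ (inj₂ (inj₂ (inj₂ (C3□⇐ S p , C2*⇐ S′ q , refl)))))))

¬Exc⇒⊕ : ∀ S S′ → (∀ v → ¬ Exc S S′ v) → 𝒢 (bistarℛ S S′) ≡ 𝒢ℛ S ⊕ 𝒢ℛ S′
¬Exc⇒⊕ S S′ ¬exc with regular⊎exceptional (clsR S) (clsR S′)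
... | inj₁ regular = trans (𝒢-bistarℛ S S′) (trans regular (sym (cong₂ _⊕_ (𝒢ℛ≡val S) (𝒢ℛ≡val S′))))
... | inj₂ exceptional with v , exc ← exceptional⇒Exc S S′ exceptional = contradiction exc (¬exc v)

theorem5 : ((S : ℛ) → Σ Cls λ c → (S′ : ℛ) → (S ∼ℛ S′) ⇔ (S′ ∈C c))
    × ((c : Cls) → Σ ℛ λ S → (S′ : ℛ) → (S ∼ℛ S′) ⇔ (S′ ∈C c))
    × ((S S′ : ℛ) →
    ((v : ℕ) → Exc S S′ v → 𝒢 (bistarℛ S S′) ≡ v)
    × (((v : ℕ) → ¬ Exc S S′ v) → 𝒢 (bistarℛ S S′) ≡ 𝒢ℛ S ⊕ 𝒢ℛ S′))
theorem5 =
    (λ S → clsR S , class-of {S} refl)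
  , (λ c → let S , e = representative c in S , class-of {S} e)
  , λ S S′ → (λ v exc → trans (𝒢-bistarℛ S S′) (Exc⇒bival S S′ exc)) , ¬Exc⇒⊕ S S′
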